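{- Let $Q=abcd$. For non-negative integers $N,M$ and $\nu,\mu\in\{0,1\}$ with $N+\nu\ge1$, $$\Phi_{2N+\nu,2M+\mu}(a,b,c,d)=\delta_{0\mu}(ac)^M\begin{bmatrix}N+M+\nu-1\\ M\end{bmatrix}_Q+\sum_{k=0}^{M+\mu-1}(ac)^k\begin{bmatrix}N+k+\nu-1\\ k\end{bmatrix}_Q\sum_{\substack{m_1,m_2,m_3,m_4\ge0\\ m_1+m_2+m_3+m_4=N}}\begin{bmatrix}M-k+m_4\\ m_4\end{bmatrix}_Q\begin{bmatrix}M-k+\mu-\nu\\ m_1\end{bmatrix}_Q(1+a\nu)a^{m_1}Q^{\binom{m_1+\nu}{2}}$$ $$\times\begin{bmatrix}M-k+\mu-1+m_2\\ m_2\end{bmatrix}_Q(ab)^{m_2}\begin{bmatrix}M-k\\ m_3\end{bmatrix}_Q(abc)^{m_3}Q^{\binom{m_3}{2}},$$ and, for non-negative integers $N,M$, $$\Psi_{N,M}(a,b,c,d)=\sum_{m=0}^{\lfloor M/2\rfloor}(-1)^m\sum_{k=0}^m\begin{bmatrix}\lfloor N/2\rfloor\\ k\end{bmatrix}_Q\begin{bmatrix}\lceil N/2\rceil\\ m-k\end{bmatrix}_Q(ac)^{m-k}Q^{k(k+1-m)+\binom{m}{2}}\Phi_{N,M-2m}(a,b,c,d).$$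
   Context: $\Phi_{N,M}(a,b,c,d)=\sum_\pi\omega^2_\pi(a,b,c,d)$ over all partitions $\pi$ with largest part $\le N$ and at most $M$ parts, and $\Psi_{N,M}(a,b,c,d)$ is the same sum restricted to partitions into distinct parts (empty partition included in both). The weight $\omega^2_\pi(a,b,c,d)$ is the product of labels when cells of each odd-indexed row of the Ferrers diagram (top row indexed 1) are labelled left to right alternately $a,b,\dots$ and cells of each even-indexed row alternately $c,d,\dots$. $\delta$ is the Kronecker delta. $\begin{bmatrix}n\\ k\end{bmatrix}_q=\frac{(q;q)_n}{(q;q)_k(q;q)_{n-k}}$ for $n\ge k\ge0$ and $0$ otherwise. -}

module Defs where

open import Level using (Level)
open import Algebra.Bundles using (CommutativeRing)
open import Data.Nat as ℕ using (ℕ; zero; suc; _∸_; _≤_; _<_; _≥_; _≡ᵇ_)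
open import Data.Nat.Properties using (_≥?_; _<?_; _≟_)
open import Data.Nat.Combinatorics using (_C_)
open import Data.Bool using (Bool; true; false; if_then_else_)
open import Data.List using (List; []; _∷_; map; concatMap; upTo; filter; foldr)
open import Data.List.Relation.Unary.Linked using (Linked; linked?)
open import Data.Sum using (_⊎_)
open import Relation.Binary.PropositionalEquality using (_≡_)
open import Relation.Nullary.Decidable using (_⊎-dec_)

-- Partitions in an M × N box.
-- A partition with at most M parts, each ≤ N, is represented (uniquely)
-- as its list of parts λ₁ ≥ λ₂ ≥ … ≥ λ_M padded with zeros to length
-- exactly M.

boxLists : ℕ → ℕ → List (List ℕ)
boxLists N zero    = [] ∷ []
boxLists N (suc M) = concatMap (λ x → map (x ∷_) (boxLists N M)) (upTo (suc N))

PartRel : ℕ → ℕ → Set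
PartRel x y = x ≥ y

-- relation between consecutive entries for partitions into distinct parts:
-- the next entry is either a padding zero or strictly smaller
DistRel : ℕ → ℕ → Set
DistRel x y = (y ≡ 0) ⊎ (y < x)

partitions : ℕ → ℕ → List (List ℕ)
partitions N M = filter (linked? (λ x y → x ≥? y)) (boxLists N M)

distinctPartitions : ℕ → ℕ → List (List ℕ)
distinctPartitions N M =
  filter (linked? (λ x y → (y ≟ 0) ⊎-dec (y <? x))) (boxLists N M)

module _ {ℓ₁ ℓ₂ : Level} (R : CommutativeRing ℓ₁ ℓ₂) where
  open CommutativeRing R

  pow : Carrier → ℕ → Carrier
  pow x zero    = 1#
  pow x (suc n) = x * pow x n

  nat : ℕ → Carrier
  nat zero    = 0#
  nat (suc n) = 1# + nat n

  δ : ℕ → ℕ → Carrier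
  δ i j = if i ≡ᵇ j then 1# else 0#

  sumBelow : ℕ → (ℕ → Carrier) → Carrier
  sumBelow zero    f = 0#
  sumBelow (suc n) f = sumBelow n f + f n

  sumList : List Carrier → Carrier
  sumList = foldr _+_ 0#

  -- Gaussian binomial coefficient [n k]_q, as a polynomial in q evaluated
  -- in R, via the q-Pascal rule [n k] = [n-1 k-1] + q^k [n-1 k];
  -- it is 0 when k > n.
  qbin : Carrier → ℕ → ℕ → Carrier
  qbin q n       zero    = 1#
  qbin q zero    (suc k) = 0#
  qbin q (suc n) (suc k) = qbin q n k + pow q (suc k) * qbin q n (suc k)

  rowWeight : Carrier → Carrier → ℕ → Carrier
  rowWeight x y zero    = 1#
  rowWeight x y (suc n) = x * rowWeight y x n

  -- ω²_π(a,b,c,d): odd-indexed rows (first row has index 1) labelled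
  -- a,b,a,…; even-indexed rows labelled c,d,c,…
  mutual
    ωOdd : Carrier → Carrier → Carrier → Carrier → List ℕ → Carrier
    ωOdd a b c d []       = 1#
    ωOdd a b c d (r ∷ rs) = rowWeight a b r * ωEven a b c d rs

    ωEven : Carrier → Carrier → Carrier → Carrier → List ℕ → Carrier
    ωEven a b c d []       = 1#
    ωEven a b c d (r ∷ rs) = rowWeight c d r * ωOdd a b c d rs

  ω² : Carrier → Carrier → Carrier → Carrier → List ℕ → Carrier
  ω² = ωOdd

  Φ : ℕ → ℕ → Carrier → Carrier → Carrier → Carrier → Carrier
  Φ N M a b c d = sumList (map (ω² a b c d) (partitions N M))

  Ψ : ℕ → ℕ → Carrier → Carrier → Carrier → Carrier → Carrier
  Ψ N M a b c d = sumList (map (ω² a b c d) (distinctPartitions N M))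

  -- Right-hand side of the first identity (Φ_{2N+ν,2M+μ}).
  -- All natural-number subtractions below are exact (never truncated)
  -- in the ranges used, given N+ν ≥ 1, ν,μ ≤ 1 and k ≤ M+μ-1.
  ΦRHS : ℕ → ℕ → ℕ → ℕ → Carrier → Carrier → Carrier → Carrier → Carrier
  ΦRHS N M ν μ a b c d =
      δ 0 μ * pow (a * c) M * qbin Q ((N ℕ.+ M ℕ.+ ν) ∸ 1) M
    + sumBelow (M ℕ.+ μ) (λ k →
        pow (a * c) k * qbin Q ((N ℕ.+ k ℕ.+ ν) ∸ 1) k *
        sumBelow (suc N) (λ m₁ → sumBelow (suc N) (λ m₂ →
        sumBelow (suc N) (λ m₃ → sumBelow (suc N) (λ m₄ →
          if (m₁ ℕ.+ m₂ ℕ.+ m₃ ℕ.+ m₄) ≡ᵇ N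
          then ( qbin Q ((M ∸ k) ℕ.+ m₄) m₄
               * qbin Q (((M ∸ k) ℕ.+ μ) ∸ ν) m₁
               * (1# + a * nat ν) * pow a m₁ * pow Q ((m₁ ℕ.+ ν) C 2)
               * qbin Q ((((M ∸ k) ℕ.+ μ) ∸ 1) ℕ.+ m₂) m₂ * pow (a * b) m₂
               * qbin Q (M ∸ k) m₃ * pow (a * b * c) m₃ * pow Q (m₃ C 2))
          else 0#)))))
    where Q = a * b * c * d

  -- Right-hand side of the second identity (Ψ_{N,M}).
  -- The exponent k(k+1-m) + binom(m,2) is computed as
  -- (k(k+1) + binom(m,2)) ∸ k m, which is exact since the integer value
  -- is always ≥ 0 for 0 ≤ k ≤ m.
  ΨRHS : ℕ → ℕ → Carrier → Carrier → Carrier → Carrier → Carrier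
  ΨRHS N M a b c d =
    sumBelow (suc (M ℕ./ 2)) (λ m →
      pow (- 1#) m *
      sumBelow (suc m) (λ k →
        qbin Q (N ℕ./ 2) k * qbin Q ((N ℕ.+ 1) ℕ./ 2) (m ∸ k)
        * pow (a * c) (m ∸ k)
        * pow Q ((k ℕ.* (k ℕ.+ 1) ℕ.+ (m C 2)) ∸ (k ℕ.* m)))
      * Φ N (M ∸ 2 ℕ.* m) a b c d)
    where Q = a * b * c * d

{-# OPTIONS --safe #-}

-- Φ and Ψ satisfy Φ_{N+1,M+1} = Φ_{N,M+1} + W Φ′_{N+1,M} and Ψ_{N+1,M+1} = Ψ_{N,M+1} + W Ψ′_{N,M},
-- where W is the weight of a first row of length N+1 and ′ exchanges (a,b) with (c,d). Eliminating
-- one ′, the row generating functions F_N = Σ_M Φ_{N,2M+μ} uᴹ and G_N = Σ_M Ψ_{N,2M+μ} uᴹ obey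
-- (1 − w u) F_{N+1} = X(F_N) and G_{N+1} = X(G_N) with the same linear operator X, where
-- w = ac Qⁿ for N+1 = 2n+1 and w = Qⁿ for N+1 = 2n is the weight of two equal rows. Hence
-- G_N = (uQ; Q)_⌊N/2⌋ (u ac; Q)_⌈N/2⌉ F_N, which is the formula for Ψ.
--
-- Likewise F_{2N+ν} = H / (u ac; Q)_{N+ν}, where H counts the partitions with no repeated odd part.
-- For a fixed number of rows, the generating function of H in the variable t marking N is a product
-- of four q-Pochhammer symbols and inverses of such. The recurrence for H in N becomes two identities
-- between these products, which reduce to polynomial identities after cancelling common factors.
-- All cancellations are done by uniqueness of the solution y of y = f + w t y.

module Submission where

open import Defs
open import Level using (Level)
open import Algebra.Bundles using (CommutativeRing; CommutativeSemiring)
import Algebra.Construct.Pointwise as Pointwise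
import Algebra.Properties.Ring as RingProperties
import Algebra.Solver.Ring.NaturalCoefficients.Default as SemiringSolver
open import Algebra.Structures using (IsCommutativeSemiring)
open import Algebra.Structures.Biased using (isCommutativeSemiringˡ)
open import Data.Bool using (Bool; true; false; _∧_; if_then_else_)
open import Data.List using (List; []; _∷_; _++_; map; concatMap; upTo; filter)
open import Data.List.Properties using (map-∘; upTo-∷ʳ)
open import Data.List.Relation.Unary.Linked using (linked?)
open import Data.Nat as ℕ using (ℕ; zero; suc; pred; _∸_; _≤_; _<_; z≤n; s≤s; _≤′_; ≤′-refl; ≤′-step; _≡ᵇ_)
open import Data.Nat.Combinatorics using (_C_; nC1≡n; nCk+nC[k+1]≡[n+1]C[k+1])
open import Data.Nat.DivMod using (_/_; m*n/n≡m; +-distrib-/-∣ʳ)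
open import Data.Nat.Divisibility using (m∣m*n)
open import Data.Nat.Properties as ℕₚ using (_≥?_; _<?_; _≟_)
open import Data.Nat.Solver using (module +-*-Solver)
open import Data.Product using (_×_; _,_)
open import Data.Sum using (inj₁; inj₂)
open import Function using (_∘_; id)
open import Relation.Binary using () renaming (Decidable to Decidable₂)
open import Relation.Binary.PropositionalEquality as ≡ using (_≡_)
import Relation.Binary.Reasoning.Setoid as SetoidReasoning
open import Relation.Nullary.Decidable using (does; dec-true; dec-false; _⊎-dec_)
open import Relation.Unary using (Decidable)

-- Formal power series with the Cauchy product.

module PowerSeries {ℓ₁ ℓ₂ : Level} (R : CommutativeRing ℓ₁ ℓ₂) where
  open CommutativeRing R
  open SemiringSolver commutativeSemiring using (solve; _:+_; _:*_; _:=_)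
  open SetoidReasoning setoid

  Series : Set ℓ₁
  Series = ℕ → Carrier

  infix  4 _≋_
  infixl 6 _⊕_
  infixl 7 _⊛_

  _≋_ : Series → Series → Set ℓ₂
  f ≋ g = ∀ n → f n ≈ g n

  _⊕_ : Series → Series → Series
  (f ⊕ g) n = f n + g n

  _⊛_ : Series → Series → Series
  (f ⊛ g) zero    = f 0 * g 0
  (f ⊛ g) (suc n) = f 0 * g (suc n) + ((f ∘ suc) ⊛ g) n

  const : Carrier → Series
  const x zero    = x
  const x (suc n) = 0#

  0ₛ 1ₛ : Series
  0ₛ _ = 0#
  1ₛ = const 1#

  ⊛-cong : ∀ {f f′ g g′} → f ≋ f′ → g ≋ g′ → f ⊛ g ≋ f′ ⊛ g′
  ⊛-cong p r zero    = *-cong (p 0) (r 0)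
  ⊛-cong p r (suc n) = +-cong (*-cong (p 0) (r (suc n))) (⊛-cong (p ∘ suc) r n)

  ⊛-distribʳ-⊕ : ∀ h f g → (f ⊕ g) ⊛ h ≋ f ⊛ h ⊕ g ⊛ h
  ⊛-distribʳ-⊕ h f g zero    = distribʳ (h 0) (f 0) (g 0)
  ⊛-distribʳ-⊕ h f g (suc n) = begin
    (f 0 + g 0) * h (suc n) + ((f ∘ suc ⊕ g ∘ suc) ⊛ h) n
      ≈⟨ +-congˡ (⊛-distribʳ-⊕ h (f ∘ suc) (g ∘ suc) n) ⟩
    (f 0 + g 0) * h (suc n) + (((f ∘ suc) ⊛ h) n + ((g ∘ suc) ⊛ h) n)
      ≈⟨ solve 5 (λ x y z u v → (x :+ y) :* z :+ (u :+ v) := (x :* z :+ u) :+ (y :* z :+ v)) refl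
           (f 0) (g 0) (h (suc n)) (((f ∘ suc) ⊛ h) n) (((g ∘ suc) ⊛ h) n) ⟩
    (f ⊛ h ⊕ g ⊛ h) (suc n) ∎

  -- The product is defined by splitting off the head of the left factor. Splitting off the head of
  -- the right factor instead is what the induction for commutativity needs.
  ⊛-suc : ∀ f g n → (f ⊛ g) (suc n) ≈ f (suc n) * g 0 + (f ⊛ (g ∘ suc)) n
  ⊛-suc f g zero    = +-comm _ _
  ⊛-suc f g (suc n) = begin
    f 0 * g (suc (suc n)) + ((f ∘ suc) ⊛ g) (suc n)
      ≈⟨ +-congˡ (⊛-suc (f ∘ suc) g n) ⟩
    f 0 * g (suc (suc n)) + (f (suc (suc n)) * g 0 + ((f ∘ suc) ⊛ (g ∘ suc)) n)
      ≈⟨ solve 3 (λ x y z → x :+ (y :+ z) := y :+ (x :+ z)) refl _ _ _ ⟩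
    f (suc (suc n)) * g 0 + (f ⊛ (g ∘ suc)) (suc n) ∎

  ⊛-comm : ∀ f g → f ⊛ g ≋ g ⊛ f
  ⊛-comm f g zero    = *-comm _ _
  ⊛-comm f g (suc n) = begin
    f 0 * g (suc n) + ((f ∘ suc) ⊛ g) n ≈⟨ +-cong (*-comm _ _) (⊛-comm (f ∘ suc) g n) ⟩
    g (suc n) * f 0 + (g ⊛ (f ∘ suc)) n ≈⟨ ⊛-suc g f n ⟨
    (g ⊛ f) (suc n) ∎

  scaled-⊛ : ∀ x f g n → ((λ m → x * f m) ⊛ g) n ≈ x * (f ⊛ g) n
  scaled-⊛ x f g zero    = *-assoc _ _ _
  scaled-⊛ x f g (suc n) = begin
    x * f 0 * g (suc n) + ((λ m → x * f (suc m)) ⊛ g) n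
      ≈⟨ +-cong (*-assoc _ _ _) (scaled-⊛ x (f ∘ suc) g n) ⟩
    x * (f 0 * g (suc n)) + x * ((f ∘ suc) ⊛ g) n
      ≈⟨ distribˡ _ _ _ ⟨
    x * (f ⊛ g) (suc n) ∎

  ⊛-assoc : ∀ f g h → (f ⊛ g) ⊛ h ≋ f ⊛ (g ⊛ h)
  ⊛-assoc f g h zero    = *-assoc _ _ _
  ⊛-assoc f g h (suc n) = begin
    f 0 * g 0 * h (suc n) + ((λ m → f 0 * g (suc m) + ((f ∘ suc) ⊛ g) m) ⊛ h) n
      ≈⟨ +-congˡ (⊛-distribʳ-⊕ h (λ m → f 0 * g (suc m)) ((f ∘ suc) ⊛ g) n) ⟩
    f 0 * g 0 * h (suc n) + (((λ m → f 0 * g (suc m)) ⊛ h) n + (((f ∘ suc) ⊛ g) ⊛ h) n)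
      ≈⟨ +-congˡ (+-cong (scaled-⊛ (f 0) (g ∘ suc) h n) (⊛-assoc (f ∘ suc) g h n)) ⟩
    f 0 * g 0 * h (suc n) + (f 0 * ((g ∘ suc) ⊛ h) n + ((f ∘ suc) ⊛ (g ⊛ h)) n)
      ≈⟨ solve 5 (λ x y z u v → x :* y :* z :+ (x :* u :+ v) := x :* (y :* z :+ u) :+ v) refl
           (f 0) (g 0) (h (suc n)) (((g ∘ suc) ⊛ h) n) (((f ∘ suc) ⊛ (g ⊛ h)) n) ⟩
    (f ⊛ (g ⊛ h)) (suc n) ∎

  ⊛-zeroˡ : ∀ f → 0ₛ ⊛ f ≋ 0ₛ
  ⊛-zeroˡ f zero    = zeroˡ _
  ⊛-zeroˡ f (suc n) = trans (+-cong (zeroˡ _) (⊛-zeroˡ f n)) (+-identityˡ 0#)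

  const-⊛ : ∀ x f n → (const x ⊛ f) n ≈ x * f n
  const-⊛ x f zero    = refl
  const-⊛ x f (suc n) = trans (+-congˡ (⊛-zeroˡ f n)) (+-identityʳ _)

  ⊛-identityˡ : ∀ f → 1ₛ ⊛ f ≋ f
  ⊛-identityˡ f n = trans (const-⊛ 1# f n) (*-identityˡ _)

  ⊛-isCommutativeSemiring : IsCommutativeSemiring _≋_ _⊕_ _⊛_ 0ₛ 1ₛ
  ⊛-isCommutativeSemiring = isCommutativeSemiringˡ record
    { +-isCommutativeMonoid = Pointwise.isCommutativeMonoid ℕ +-isCommutativeMonoid
    ; *-isCommutativeMonoid = record
      { isMonoid = record
        { isSemigroup = record
          { isMagma = record
            { isEquivalence = Pointwise.isEquivalence ℕ isEquivalence
            ; ∙-cong        = ⊛-cong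
            }
          ; assoc = ⊛-assoc
          }
        ; identity = ⊛-identityˡ , λ f n → trans (⊛-comm f 1ₛ n) (⊛-identityˡ f n)
        }
      ; comm = ⊛-comm
      }
    ; distribʳ = ⊛-distribʳ-⊕
    ; zeroˡ    = ⊛-zeroˡ
    }

  seriesSemiring : CommutativeSemiring ℓ₁ ℓ₂
  seriesSemiring = record { isCommutativeSemiring = ⊛-isCommutativeSemiring }

  const-+ : ∀ x y → const (x + y) ≋ const x ⊕ const y
  const-+ x y zero    = refl
  const-+ x y (suc n) = sym (+-identityˡ 0#)

  const-* : ∀ x y → const (x * y) ≋ const x ⊛ const y
  const-* x y zero    = refl
  const-* x y (suc n) = sym (trans (const-⊛ x (const y) (suc n)) (zeroʳ x))

  const-cong : ∀ {x y} → x ≈ y → const x ≋ const y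
  const-cong p zero    = p
  const-cong p (suc n) = refl

  𝐭 : Series
  𝐭 zero          = 0#
  𝐭 (suc zero)    = 1#
  𝐭 (suc (suc n)) = 0#

  𝐭⊛-zero : ∀ f → (𝐭 ⊛ f) 0 ≈ 0#
  𝐭⊛-zero f = zeroˡ _

  𝐭⊛-suc : ∀ f n → (𝐭 ⊛ f) (suc n) ≈ f n
  𝐭⊛-suc f n = begin
    0# * f (suc n) + ((𝐭 ∘ suc) ⊛ f) n ≈⟨ +-cong (zeroˡ _) (⊛-cong 𝐭-tail (λ _ → refl) n) ⟩
    0# + (1ₛ ⊛ f) n                    ≈⟨ +-identityˡ _ ⟩
    (1ₛ ⊛ f) n                         ≈⟨ ⊛-identityˡ f n ⟩
    f n                                ∎
    where
    𝐭-tail : 𝐭 ∘ suc ≋ 1ₛ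
    𝐭-tail zero    = refl
    𝐭-tail (suc n) = refl

  module S = CommutativeSemiring seriesSemiring

  -- Apart from `f`, coefficient n + 1 of the right side involves only coefficient n of the unknown,
  -- so the solution is determined by induction. This replaces division by 1 - w t: series are used
  -- only as a semiring.
  unique-fixpoint : ∀ w f {g h} → g ≋ f ⊕ const w ⊛ (𝐭 ⊛ g) → h ≋ f ⊕ const w ⊛ (𝐭 ⊛ h) → g ≋ h
  unique-fixpoint w f {g} {h} p r zero = begin
    g 0                                  ≈⟨ p 0 ⟩
    f 0 + w * (𝐭 ⊛ g) 0                  ≈⟨ +-congˡ (*-congˡ (trans (𝐭⊛-zero g) (sym (𝐭⊛-zero h)))) ⟩
    f 0 + w * (𝐭 ⊛ h) 0                  ≈⟨ r 0 ⟨
    h 0                                  ∎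
  unique-fixpoint w f {g} {h} p r (suc n) = begin
    g (suc n)                            ≈⟨ p (suc n) ⟩
    f (suc n) + (const w ⊛ (𝐭 ⊛ g)) (suc n)
      ≈⟨ +-congˡ (trans (const-⊛ w (𝐭 ⊛ g) (suc n)) (*-congˡ (𝐭⊛-suc g n))) ⟩
    f (suc n) + w * g n                  ≈⟨ +-congˡ (*-congˡ (unique-fixpoint w f p r n)) ⟩
    f (suc n) + w * h n
      ≈⟨ +-congˡ (trans (const-⊛ w (𝐭 ⊛ h) (suc n)) (*-congˡ (𝐭⊛-suc h n))) ⟨
    f (suc n) + (const w ⊛ (𝐭 ⊛ h)) (suc n) ≈⟨ r (suc n) ⟨
    h (suc n)                            ∎

  -- Powers and the dilation of the variable.

  _^_ : Carrier → ℕ → Carrier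
  _^_ = pow R

  infixr 8 _^_

  ^-cong : ∀ n {x y} → x ≈ y → x ^ n ≈ y ^ n
  ^-cong zero    p = refl
  ^-cong (suc n) p = *-cong p (^-cong n p)

  ^-+ : ∀ x m n → x ^ (m ℕ.+ n) ≈ x ^ m * x ^ n
  ^-+ x zero    n = sym (*-identityˡ _)
  ^-+ x (suc m) n = trans (*-congˡ (^-+ x m n)) (sym (*-assoc _ _ _))

  *-^ : ∀ x y n → (x * y) ^ n ≈ x ^ n * y ^ n
  *-^ x y zero    = sym (*-identityˡ 1#)
  *-^ x y (suc n) = begin
    x * y * (x * y) ^ n       ≈⟨ *-congˡ (*-^ x y n) ⟩
    x * y * (x ^ n * y ^ n)   ≈⟨ solve 4 (λ x y u v → x :* y :* (u :* v) := x :* u :* (y :* v)) refl x y (x ^ n) (y ^ n) ⟩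
    x * x ^ n * (y * y ^ n)   ∎

  -- The substitution t ↦ xt.
  dilate : Carrier → Series → Series
  dilate x f n = x ^ n * f n

  dilate-⊛ : ∀ x f g → dilate x (f ⊛ g) ≋ dilate x f ⊛ dilate x g
  dilate-⊛ x f g zero = begin
    1# * (f 0 * g 0)        ≈⟨ *-identityˡ _ ⟩
    f 0 * g 0               ≈⟨ *-cong (*-identityˡ _) (*-identityˡ _) ⟨
    1# * f 0 * (1# * g 0)   ∎
  dilate-⊛ x f g (suc n) = begin
    x ^ suc n * (f 0 * g (suc n) + ((f ∘ suc) ⊛ g) n)
      ≈⟨ solve 5 (λ x p f g h → (x :* p) :* (f :* g :+ h) := f :* (x :* p :* g) :+ x :* (p :* h)) refl
           x (x ^ n) (f 0) (g (suc n)) (((f ∘ suc) ⊛ g) n) ⟩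
    f 0 * (x ^ suc n * g (suc n)) + x * dilate x ((f ∘ suc) ⊛ g) n
      ≈⟨ +-cong (*-congʳ (sym (*-identityˡ _))) (*-congˡ (dilate-⊛ x (f ∘ suc) g n)) ⟩
    dilate x f 0 * dilate x g (suc n) + x * (dilate x (f ∘ suc) ⊛ dilate x g) n
      ≈⟨ +-congˡ (scaled-⊛ x (dilate x (f ∘ suc)) (dilate x g) n) ⟨
    dilate x f 0 * dilate x g (suc n) + ((λ m → x * dilate x (f ∘ suc) m) ⊛ dilate x g) n
      ≈⟨ +-congˡ (⊛-cong (λ m → sym (*-assoc _ _ _)) (λ _ → refl) n) ⟩
    (dilate x f ⊛ dilate x g) (suc n) ∎

  dilate-const : ∀ x y → dilate x (const y) ≋ const y
  dilate-const x y zero    = *-identityˡ y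
  dilate-const x y (suc n) = zeroʳ _

  -- Finite sums and the coefficients of products.

  sumBelow-cong : ∀ n {f g} → f ≋ g → sumBelow R n f ≈ sumBelow R n g
  sumBelow-cong zero    p = refl
  sumBelow-cong (suc n) p = +-cong (sumBelow-cong n p) (p n)

  sumBelow-cong-< : ∀ n {f g} → (∀ k → k < n → f k ≈ g k) → sumBelow R n f ≈ sumBelow R n g
  sumBelow-cong-< zero    p = refl
  sumBelow-cong-< (suc n) p =
    +-cong (sumBelow-cong-< n λ k k<n → p k (ℕₚ.m≤n⇒m≤1+n k<n)) (p n ℕₚ.≤-refl)

  sumBelow-suc : ∀ n f → sumBelow R (suc n) f ≈ f 0 + sumBelow R n (f ∘ suc)
  sumBelow-suc zero    f = +-comm _ _
  sumBelow-suc (suc n) f = trans (+-congʳ (sumBelow-suc n f)) (+-assoc _ _ _)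

  *-distribˡ-sumBelow : ∀ x n f → x * sumBelow R n f ≈ sumBelow R n (λ k → x * f k)
  *-distribˡ-sumBelow x zero    f = zeroʳ x
  *-distribˡ-sumBelow x (suc n) f = trans (distribˡ _ _ _) (+-congʳ (*-distribˡ-sumBelow x n f))

  sumBelow-0 : ∀ n → sumBelow R n 0ₛ ≈ 0#
  sumBelow-0 zero    = refl
  sumBelow-0 (suc n) = trans (+-identityʳ _) (sumBelow-0 n)

  ⊛-as-sum : ∀ f g n → (f ⊛ g) n ≈ sumBelow R (suc n) (λ k → f k * g (n ∸ k))
  ⊛-as-sum f g zero    = sym (+-identityˡ _)
  ⊛-as-sum f g (suc n) = begin
    f 0 * g (suc n) + ((f ∘ suc) ⊛ g) n
      ≈⟨ +-congˡ (⊛-as-sum (f ∘ suc) g n) ⟩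
    f 0 * g (suc n) + sumBelow R (suc n) (λ k → f (suc k) * g (n ∸ k))
      ≈⟨ sumBelow-suc (suc n) (λ k → f k * g (suc n ∸ k)) ⟨
    sumBelow R (suc (suc n)) (λ k → f k * g (suc n ∸ k)) ∎

  -- Multiplication by the `m`-th power of the variable. Applied to `1ₛ` it gives the Kronecker
  -- delta that becomes the condition on m₁ + m₂ + m₃ + m₄.
  delay : ℕ → Series → Series
  delay zero    f n       = f n
  delay (suc m) f zero    = 0#
  delay (suc m) f (suc n) = delay m f n

  delay-delay : ∀ m k f → delay m (delay k f) ≋ delay (m ℕ.+ k) f
  delay-delay zero    k f n       = refl
  delay-delay (suc m) k f zero    = refl
  delay-delay (suc m) k f (suc n) = delay-delay m k f n

  delay-⊛ : ∀ m f g → delay m (f ⊛ g) ≋ f ⊛ delay m g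
  delay-⊛ zero    f g n       = refl
  delay-⊛ (suc m) f g zero    = sym (zeroʳ _)
  delay-⊛ (suc m) f g (suc n) = begin
    delay m (f ⊛ g) n                       ≈⟨ delay-⊛ m f g n ⟩
    (f ⊛ delay m g) n                       ≈⟨ +-identityˡ _ ⟨
    0# + (f ⊛ delay m g) n                  ≈⟨ +-congʳ (zeroʳ _) ⟨
    f (suc n) * 0# + (f ⊛ delay m g) n      ≈⟨ ⊛-suc f (delay (suc m) g) n ⟨
    (f ⊛ delay (suc m) g) (suc n)           ∎

  delay-1ₛ : ∀ m n → delay m 1ₛ n ≡ δ R m n
  delay-1ₛ zero    zero    = ≡.refl
  delay-1ₛ zero    (suc n) = ≡.refl
  delay-1ₛ (suc m) zero    = ≡.refl
  delay-1ₛ (suc m) (suc n) = delay-1ₛ m n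

  -- Terms with `m` greater than `n` vanish because `delay m g n` is then zero, so every bound `K`
  -- above `n` serves. A bound independent of the other indices gives the multiple sum its
  -- box-shaped range.
  ⊛-as-delays : ∀ f g n K → n < K → (f ⊛ g) n ≈ sumBelow R K (λ m → f m * delay m g n)
  ⊛-as-delays f g zero (suc K) _ = begin
    f 0 * g 0                                        ≈⟨ +-identityʳ _ ⟨
    f 0 * g 0 + 0#                                   ≈⟨ +-congˡ (sumBelow-0 K) ⟨
    f 0 * g 0 + sumBelow R K 0ₛ                      ≈⟨ +-congˡ (sumBelow-cong K λ m → sym (zeroʳ _)) ⟩
    f 0 * g 0 + sumBelow R K (λ m → f (suc m) * 0#)  ≈⟨ sumBelow-suc K (λ m → f m * delay m g 0) ⟨
    sumBelow R (suc K) (λ m → f m * delay m g 0)     ∎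
  ⊛-as-delays f g (suc n) (suc K) (s≤s n<K) = begin
    f 0 * g (suc n) + ((f ∘ suc) ⊛ g) n
      ≈⟨ +-congˡ (⊛-as-delays (f ∘ suc) g n K n<K) ⟩
    f 0 * g (suc n) + sumBelow R K (λ m → f (suc m) * delay m g n)
      ≈⟨ sumBelow-suc K (λ m → f m * delay m g (suc n)) ⟨
    sumBelow R (suc K) (λ m → f m * delay m g (suc n)) ∎

  delay-⊛-as-delays : ∀ k f g n K → n < K →
    delay k (f ⊛ g) n ≈ sumBelow R K (λ m → f m * delay (k ℕ.+ m) g n)
  delay-⊛-as-delays k f g n K n<K = begin
    delay k (f ⊛ g) n                                      ≈⟨ delay-⊛ k f g n ⟩
    (f ⊛ delay k g) n                                      ≈⟨ ⊛-as-delays f (delay k g) n K n<K ⟩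
    sumBelow R K (λ m → f m * delay m (delay k g) n)       ≈⟨ sumBelow-cong K (λ m → *-congˡ (delay-delay m k g n)) ⟩
    sumBelow R K (λ m → f m * delay (m ℕ.+ k) g n)
      ≈⟨ sumBelow-cong K (λ m → *-congˡ (reflexive (≡.cong (λ j → delay j g n) (ℕₚ.+-comm m k)))) ⟩
    sumBelow R K (λ m → f m * delay (k ℕ.+ m) g n)         ∎

  ⊛-as-quadruple-sum : ∀ f g h k n (F : ℕ → ℕ → ℕ → ℕ → Carrier) →
    (∀ m₁ m₂ m₃ m₄ → f m₁ * (g m₂ * (h m₃ * k m₄)) ≈ F m₁ m₂ m₃ m₄) →
    (f ⊛ (g ⊛ (h ⊛ k))) n ≈
      sumBelow R (suc n) (λ m₁ → sumBelow R (suc n) (λ m₂ →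
      sumBelow R (suc n) (λ m₃ → sumBelow R (suc n) (λ m₄ →
        if (m₁ ℕ.+ m₂ ℕ.+ m₃ ℕ.+ m₄) ≡ᵇ n then F m₁ m₂ m₃ m₄ else 0#))))
  ⊛-as-quadruple-sum f g h k n F p = begin
    (f ⊛ (g ⊛ (h ⊛ k))) n
      -- The trailing `1ₛ` lets the fourth factor be expanded like the other three; its delay by all
      -- four indices is the indicator of their sum being `n`.
      ≈⟨ ⊛-cong (λ _ → refl) (⊛-cong (λ _ → refl) (⊛-cong (λ _ → refl) (λ m → sym (⊛-identityʳ k m)))) n ⟩
    (f ⊛ (g ⊛ (h ⊛ (k ⊛ 1ₛ)))) n
      ≈⟨ ⊛-as-delays f _ n K n<K ⟩
    (∑ λ m₁ → f m₁ * delay m₁ (g ⊛ (h ⊛ (k ⊛ 1ₛ))) n)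
      ≈⟨ (sumBelow-cong K λ m₁ → step (f m₁) m₁ g (h ⊛ (k ⊛ 1ₛ))) ⟩
    (∑ λ m₁ → ∑ λ m₂ → f m₁ * (g m₂ * delay (m₁ ℕ.+ m₂) (h ⊛ (k ⊛ 1ₛ)) n))
      ≈⟨ (sumBelow-cong K λ m₁ → sumBelow-cong K λ m₂ → trans (sym (*-assoc _ _ _))
           (step (f m₁ * g m₂) (m₁ ℕ.+ m₂) h (k ⊛ 1ₛ))) ⟩
    (∑ λ m₁ → ∑ λ m₂ → ∑ λ m₃ → f m₁ * g m₂ * (h m₃ * delay (m₁ ℕ.+ m₂ ℕ.+ m₃) (k ⊛ 1ₛ) n))
      ≈⟨ (sumBelow-cong K λ m₁ → sumBelow-cong K λ m₂ → sumBelow-cong K λ m₃ → trans (sym (*-assoc _ _ _))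
           (step (f m₁ * g m₂ * h m₃) (m₁ ℕ.+ m₂ ℕ.+ m₃) k 1ₛ)) ⟩
    (∑ λ m₁ → ∑ λ m₂ → ∑ λ m₃ → ∑ λ m₄ →
      f m₁ * g m₂ * h m₃ * (k m₄ * delay (m₁ ℕ.+ m₂ ℕ.+ m₃ ℕ.+ m₄) 1ₛ n))
      ≈⟨ (sumBelow-cong K λ m₁ → sumBelow-cong K λ m₂ → sumBelow-cong K λ m₃ → sumBelow-cong K λ m₄ →
           trans (*-congˡ (*-congˡ (reflexive (delay-1ₛ (m₁ ℕ.+ m₂ ℕ.+ m₃ ℕ.+ m₄) n))))
             (select m₁ m₂ m₃ m₄ ((m₁ ℕ.+ m₂ ℕ.+ m₃ ℕ.+ m₄) ≡ᵇ n))) ⟩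
    (∑ λ m₁ → ∑ λ m₂ → ∑ λ m₃ → ∑ λ m₄ →
      if (m₁ ℕ.+ m₂ ℕ.+ m₃ ℕ.+ m₄) ≡ᵇ n then F m₁ m₂ m₃ m₄ else 0#) ∎
    where
    K = suc n
    n<K = ℕₚ.n<1+n n
    ∑ = sumBelow R K
    ⊛-identityʳ = S.*-identityʳ
    step : ∀ x k f g → x * delay k (f ⊛ g) n ≈ ∑ (λ m → x * (f m * delay (k ℕ.+ m) g n))
    step x k f g = trans (*-congˡ (delay-⊛-as-delays k f g n K n<K)) (*-distribˡ-sumBelow x K _)
    select : ∀ m₁ m₂ m₃ m₄ b → f m₁ * g m₂ * h m₃ * (k m₄ * (if b then 1# else 0#))
           ≈ (if b then F m₁ m₂ m₃ m₄ else 0#)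
    select m₁ m₂ m₃ m₄ true  = trans
      (trans (*-congˡ (*-identityʳ _))
        (solve 4 (λ x y z w → x :* y :* z :* w := x :* (y :* (z :* w))) refl (f m₁) (g m₂) (h m₃) (k m₄)))
      (p m₁ m₂ m₃ m₄)
    select m₁ m₂ m₃ m₄ false = trans (*-congˡ (zeroʳ _)) (zeroʳ _)

suc-C-2 : ∀ m → suc m C 2 ≡ m ℕ.+ m C 2
suc-C-2 m = ≡.trans (≡.sym (nCk+nC[k+1]≡[n+1]C[k+1] m 1)) (≡.cong (ℕ._+ m C 2) (nC1≡n m))

-- Finite q-Pochhammer products and their inverses.

module QProducts {ℓ₁ ℓ₂ : Level} (R : CommutativeRing ℓ₁ ℓ₂) (q : CommutativeRing.Carrier R) where
  open CommutativeRing R hiding (zero)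
  open PowerSeries R
  open SemiringSolver commutativeSemiring using (solve; _:+_; _:*_; _:=_)
  open SetoidReasoning setoid

  affine-zero : ∀ f w g → (f ⊕ const w ⊛ (𝐭 ⊛ g)) 0 ≈ f 0
  affine-zero f w g = trans (+-congˡ (trans (*-congˡ (zeroˡ _)) (zeroʳ w))) (+-identityʳ _)

  affine-suc : ∀ f w g n → (f ⊕ const w ⊛ (𝐭 ⊛ g)) (suc n) ≈ f (suc n) + w * g n
  affine-suc f w g n = +-congˡ (trans (const-⊛ w (𝐭 ⊛ g) (suc n)) (*-congˡ (𝐭⊛-suc g n)))

  -- E n x = (−xt; q)ₙ and I n x = 1 / (xt; q)ₙ, expanded by the q-binomial theorem.
  E I : ℕ → Carrier → Series
  E n x m = qbin R q n m * (q ^ (m C 2) * x ^ m)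
  I n x m = qbin R q ((n ℕ.+ m) ∸ 1) m * x ^ m

  E-cong : ∀ n {x y} → x ≈ y → E n x ≋ E n y
  E-cong n p m = *-congˡ (*-congˡ (^-cong m p))

  I-cong : ∀ n {x y} → x ≈ y → I n x ≋ I n y
  I-cong n p m = *-congˡ (^-cong m p)

  dilate-E : ∀ y n x → dilate y (E n x) ≋ E n (y * x)
  dilate-E y n x m = trans
    (solve 4 (λ y b p x → y :* (b :* (p :* x)) := b :* (p :* (y :* x))) refl (y ^ m) _ _ (x ^ m))
    (*-congˡ (*-congˡ (sym (*-^ y x m))))

  dilate-I : ∀ y n x → dilate y (I n x) ≋ I n (y * x)
  dilate-I y n x m = trans
    (solve 3 (λ y b x → y :* (b :* x) := b :* (y :* x)) refl (y ^ m) _ (x ^ m))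
    (*-congˡ (sym (*-^ y x m)))

  E-constant-term : ∀ n x → E n x 0 ≈ 1#
  E-constant-term n x = trans (*-identityˡ _) (*-identityˡ _)

  I-constant-term : ∀ n x → I n x 0 ≈ 1#
  I-constant-term n x = *-identityˡ _

  E-zero : ∀ x → E 0 x ≋ 1ₛ
  E-zero x zero    = E-constant-term 0 x
  E-zero x (suc m) = zeroˡ _

  -- One of the two terms of Pascal's rule lies one step further above the diagonal, so the
  -- induction treats all distances `suc d` at once.
  qbin-diagonal-0 : ∀ m → qbin R q m (suc m) ≈ 0#
  qbin-diagonal-0 m = go m zero
    where
    go : ∀ m d → qbin R q m (suc d ℕ.+ m) ≈ 0#
    go zero    d = reflexive (≡.cong (qbin R q 0) (≡.cong suc (ℕₚ.+-identityʳ d)))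
    go (suc m) d = begin
      qbin R q m (d ℕ.+ suc m) + r * qbin R q m (suc (d ℕ.+ suc m))
        ≈⟨ +-cong (reflexive (≡.cong (qbin R q m) (ℕₚ.+-suc d m)))
                  (*-congˡ (reflexive (≡.cong (λ j → qbin R q m (suc j)) (ℕₚ.+-suc d m)))) ⟩
      qbin R q m (suc d ℕ.+ m) + r * qbin R q m (suc (suc d) ℕ.+ m)
        ≈⟨ +-cong (go m d) (trans (*-congˡ (go m (suc d))) (zeroʳ _)) ⟩
      0# + 0#  ≈⟨ +-identityˡ 0# ⟩
      0#       ∎
      where
      r = q ^ suc (d ℕ.+ suc m)

  -- For `n` = 0 the upper index is `m ∸ 1`. Truncation makes it 0 at `m` = 0, where the coefficient
  -- is 1; for larger `m` the binomial lies just above the diagonal and vanishes.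
  I-zero : ∀ x → I 0 x ≋ 1ₛ
  I-zero x zero    = I-constant-term 0 x
  I-zero x (suc m) = trans (*-congʳ (qbin-diagonal-0 m)) (zeroˡ _)

  -- The first factor 1 + x t is split off. Coefficientwise this is Pascal's rule, the powers of `q`
  -- being matched by C(m+1, 2) = m + C(m, 2).
  E-sucˡ : ∀ n x → E (suc n) x ≋ E n (q * x) ⊕ const x ⊛ (𝐭 ⊛ E n (q * x))
  E-sucˡ n x zero = sym (affine-zero (E n (q * x)) x (E n (q * x)))
  E-sucˡ n x (suc m) = begin
    (b + q ^ suc m * b′) * (q ^ (suc m C 2) * x ^ suc m)
      ≈⟨ *-congˡ (*-congʳ triangle) ⟩
    (b + q ^ suc m * b′) * (q ^ m * p * x ^ suc m)
      ≈⟨ solve 7 (λ q x b b′ r p y → (b :+ q :* r :* b′) :* (r :* p :* (x :* y)) :=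
                                     b′ :* (r :* p :* (q :* r :* (x :* y))) :+ x :* (b :* (p :* (r :* y))))
           refl q x b b′ (q ^ m) p (x ^ m) ⟩
    b′ * (q ^ m * p * (q ^ suc m * x ^ suc m)) + x * (b * (p * (q ^ m * x ^ m)))
      ≈⟨ +-cong (*-congˡ (*-cong triangle (*-^ q x (suc m)))) (*-congˡ (*-congˡ (*-congˡ (*-^ q x m)))) ⟨
    E n (q * x) (suc m) + x * E n (q * x) m
      ≈⟨ affine-suc (E n (q * x)) x (E n (q * x)) m ⟨
    (E n (q * x) ⊕ const x ⊛ (𝐭 ⊛ E n (q * x))) (suc m) ∎
    where
    b  = qbin R q n m
    b′ = qbin R q n (suc m)
    p  = q ^ (m C 2)
    triangle : q ^ (suc m C 2) ≈ q ^ m * p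
    triangle = trans (reflexive (≡.cong (q ^_) (suc-C-2 m))) (^-+ q m (m C 2))

  -- Multiplication by 1 - x t removes the first factor of the denominator. The fixpoint form avoids
  -- inverses and is the shape that `unique-fixpoint` takes.
  I-sucˡ : ∀ n x → I (suc n) x ≋ I n (q * x) ⊕ const x ⊛ (𝐭 ⊛ I (suc n) x)
  I-sucˡ n x zero = sym (affine-zero (I n (q * x)) x (I (suc n) x))
  I-sucˡ n x (suc m) = trans lemma (sym (affine-suc (I n (q * x)) x (I (suc n) x) m))
    where
    lemma : I (suc n) x (suc m) ≈ I n (q * x) (suc m) + x * I (suc n) x m
    -- The upper index `n + suc m` must become `suc (n + m)` before Pascal's rule can unfold.
    lemma rewrite ℕₚ.+-suc n m = begin
      (b + q ^ suc m * b′) * x ^ suc m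
        ≈⟨ solve 5 (λ b b′ r x y → (b :+ r :* b′) :* (x :* y) := b′ :* (r :* (x :* y)) :+ x :* (b :* y))
             refl b b′ (q ^ suc m) x (x ^ m) ⟩
      b′ * (q ^ suc m * x ^ suc m) + x * (b * x ^ m)
        ≈⟨ +-congʳ (*-congˡ (*-^ q x (suc m))) ⟨
      b′ * (q * x) ^ suc m + x * (b * x ^ m) ∎
      where
      b  = qbin R q (n ℕ.+ m) m
      b′ = qbin R q (n ℕ.+ m) (suc m)

-- Splitting off the last factor.

module QProductRecurrences {ℓ₁ ℓ₂ : Level} (R : CommutativeRing ℓ₁ ℓ₂) (q : CommutativeRing.Carrier R) where
  open CommutativeRing R hiding (zero)
  open PowerSeries R
  open QProducts R q
  open SemiringSolver commutativeSemiring using () renaming (solve to solveᵣ; _:+_ to _⊞_; _:*_ to _⊠_; _:=_ to _≔_)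
  open SemiringSolver seriesSemiring using (solve; _:+_; _:*_; _:=_)
  open SetoidReasoning S.setoid

  -- Induction on `n`: both the first and the last factor are split off, and these two linear
  -- factors commute. No second form of Pascal's rule is involved.
  E-sucʳ : ∀ n x → E (suc n) x ≋ E n x ⊕ const (x * q ^ n) ⊛ (𝐭 ⊛ E n x)
  E-sucʳ zero x = begin
    E 1 x                                      ≈⟨ E-sucˡ 0 x ⟩
    E 0 (q * x) ⊕ const x ⊛ (𝐭 ⊛ E 0 (q * x))
      ≈⟨ S.+-cong E₀ (S.*-cong (const-cong (sym (*-identityʳ x))) (S.*-congˡ E₀)) ⟩
    E 0 x ⊕ const (x * 1#) ⊛ (𝐭 ⊛ E 0 x)      ∎
    where
    E₀ : E 0 (q * x) ≋ E 0 x
    E₀ = S.trans (E-zero (q * x)) (S.sym (E-zero x))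
  E-sucʳ (suc n) x = begin
    E (suc (suc n)) x
      ≈⟨ E-sucˡ (suc n) x ⟩
    E (suc n) (q * x) ⊕ X ⊛ (𝐭 ⊛ E (suc n) (q * x))
      ≈⟨ S.+-cong ih (S.*-congˡ (S.*-congˡ ih)) ⟩
    (g ⊕ W ⊛ (𝐭 ⊛ g)) ⊕ X ⊛ (𝐭 ⊛ (g ⊕ W ⊛ (𝐭 ⊛ g)))
      ≈⟨ solve 4 (λ g w x t → (g :+ w :* (t :* g)) :+ x :* (t :* (g :+ w :* (t :* g))) :=
                              (g :+ x :* (t :* g)) :+ w :* (t :* (g :+ x :* (t :* g)))) S.refl g W X 𝐭 ⟩
    (g ⊕ X ⊛ (𝐭 ⊛ g)) ⊕ W ⊛ (𝐭 ⊛ (g ⊕ X ⊛ (𝐭 ⊛ g)))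
      ≈⟨ S.+-cong (E-sucˡ n x) (S.*-congˡ (S.*-congˡ (E-sucˡ n x))) ⟨
    E (suc n) x ⊕ W ⊛ (𝐭 ⊛ E (suc n) x)
      ≈⟨ S.+-congˡ (S.*-congʳ (const-cong (solveᵣ 3 (λ q x p → q ⊠ x ⊠ p ≔ x ⊠ (q ⊠ p)) refl q x (q ^ n)))) ⟩
    E (suc n) x ⊕ const (x * q ^ suc n) ⊛ (𝐭 ⊛ E (suc n) x) ∎
    where
    g = E n (q * x)
    X = const x
    W = const (q * x * q ^ n)
    ih : E (suc n) (q * x) ≋ g ⊕ W ⊛ (𝐭 ⊛ g)
    ih = E-sucʳ n (q * x)

  -- In the inductive step the right side is shown to solve the equation `I-sucˡ`, which determines
  -- `I (suc (suc n)) x`.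
  I-sucʳ : ∀ n x → I (suc n) x ≋ I n x ⊕ const (x * q ^ n) ⊛ (𝐭 ⊛ I (suc n) x)
  I-sucʳ zero x = begin
    I 1 x                                      ≈⟨ I-sucˡ 0 x ⟩
    I 0 (q * x) ⊕ const x ⊛ (𝐭 ⊛ I 1 x)
      ≈⟨ S.+-cong (S.trans (I-zero (q * x)) (S.sym (I-zero x))) (S.*-congʳ (const-cong (sym (*-identityʳ x)))) ⟩
    I 0 x ⊕ const (x * 1#) ⊛ (𝐭 ⊛ I 1 x)      ∎
  I-sucʳ (suc n) x = unique-fixpoint x (I (suc n) (q * x)) (I-sucˡ (suc n) x) (begin
    I (suc n) x ⊕ const (x * q ^ suc n) ⊛ (𝐭 ⊛ I (suc (suc n)) x)
      ≈⟨ S.+-congˡ (S.*-congʳ (const-cong (solveᵣ 3 (λ q x p → x ⊠ (q ⊠ p) ≔ q ⊠ x ⊠ p) refl q x (q ^ n)))) ⟩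
    I (suc n) x ⊕ W ⊛ (𝐭 ⊛ I (suc (suc n)) x)
      ≈⟨ S.+-cong (I-sucˡ n x) (S.*-congˡ (S.*-congˡ (I-sucˡ (suc n) x))) ⟩
    (f ⊕ X ⊛ (𝐭 ⊛ h)) ⊕ W ⊛ (𝐭 ⊛ (g ⊕ X ⊛ (𝐭 ⊛ k)))
      ≈⟨ solve 7 (λ f g h k x w t → (f :+ x :* (t :* h)) :+ w :* (t :* (g :+ x :* (t :* k))) :=
                                    (f :+ w :* (t :* g)) :+ x :* (t :* (h :+ w :* (t :* k)))) S.refl f g h k X W 𝐭 ⟩
    (f ⊕ W ⊛ (𝐭 ⊛ g)) ⊕ X ⊛ (𝐭 ⊛ (h ⊕ W ⊛ (𝐭 ⊛ k)))
      ≈⟨ S.+-cong (I-sucʳ n (q * x))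
           (S.*-congˡ (S.*-congˡ (S.+-congˡ (S.*-congʳ (const-cong (solveᵣ 3 (λ q x p → x ⊠ (q ⊠ p) ≔ q ⊠ x ⊠ p) refl q x (q ^ n))))))) ⟨
    g ⊕ X ⊛ (𝐭 ⊛ (h ⊕ const (x * q ^ suc n) ⊛ (𝐭 ⊛ k))) ∎)
    where
    f = I n (q * x)
    g = I (suc n) (q * x)
    h = I (suc n) x
    k = I (suc (suc n)) x
    X = const x
    W = const (q * x * q ^ n)

-- From filtered lists in a box to nested sums over the rows.

module BoxSums {ℓ₁ ℓ₂ : Level} (R : CommutativeRing ℓ₁ ℓ₂) where
  open CommutativeRing R hiding (zero)
  open PowerSeries R
  open SetoidReasoning setoid

  sumOver : {A : Set} → List A → (A → Carrier) → Carrier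
  sumOver xs f = sumList R (map f xs)

  sumOver-cong : {A : Set} {f g : A → Carrier} (xs : List A) → (∀ x → f x ≈ g x) → sumOver xs f ≈ sumOver xs g
  sumOver-cong []       p = refl
  sumOver-cong (x ∷ xs) p = +-cong (p x) (sumOver-cong xs p)

  sumOver-++ : {A : Set} (f : A → Carrier) (xs ys : List A) → sumOver (xs ++ ys) f ≈ sumOver xs f + sumOver ys f
  sumOver-++ f []       ys = sym (+-identityˡ _)
  sumOver-++ f (x ∷ xs) ys = trans (+-congˡ (sumOver-++ f xs ys)) (sym (+-assoc _ _ _))

  sumOver-concatMap : {A B : Set} (f : B → Carrier) (g : A → List B) (xs : List A) →
    sumOver (concatMap g xs) f ≈ sumOver xs (λ x → sumOver (g x) f)
  sumOver-concatMap f g []       = refl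
  sumOver-concatMap f g (x ∷ xs) =
    trans (sumOver-++ f (g x) (concatMap g xs)) (+-congˡ (sumOver-concatMap f g xs))

  sumOver-upTo : ∀ n f → sumOver (upTo n) f ≈ sumBelow R n f
  sumOver-upTo zero    f = refl
  sumOver-upTo (suc n) f = begin
    sumOver (upTo (suc n)) f              ≈⟨ reflexive (≡.cong (λ l → sumOver l f) (upTo-∷ʳ n)) ⟨
    sumOver (upTo n ++ n ∷ []) f          ≈⟨ sumOver-++ f (upTo n) (n ∷ []) ⟩
    sumOver (upTo n) f + (f n + 0#)       ≈⟨ +-cong (sumOver-upTo n f) (+-identityʳ _) ⟩
    sumBelow R n f + f n                  ∎

  sumOver-filter : {A : Set} {P : A → Set} (P? : Decidable P) (f : A → Carrier) (xs : List A) →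
    sumOver (filter P? xs) f ≈ sumOver xs (λ x → if does (P? x) then f x else 0#)
  sumOver-filter P? f []       = refl
  sumOver-filter P? f (x ∷ xs) with does (P? x)
  ... | true  = +-congˡ (sumOver-filter P? f xs)
  ... | false = trans (sumOver-filter P? f xs) (sym (+-identityˡ _))

  *-distribˡ-sumOver : {A : Set} (x : Carrier) (f : A → Carrier) (xs : List A) →
    sumOver xs (λ y → x * f y) ≈ x * sumOver xs f
  *-distribˡ-sumOver x f []       = sym (zeroʳ x)
  *-distribˡ-sumOver x f (y ∷ xs) = trans (+-congˡ (*-distribˡ-sumOver x f xs)) (sym (distribˡ _ _ _))

  sumOver-0 : {A : Set} (xs : List A) → sumOver xs (λ _ → 0#) ≈ 0#
  sumOver-0 []       = refl
  sumOver-0 (x ∷ xs) = trans (+-identityˡ _) (sumOver-0 xs)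

  sumOver-boxLists : ∀ N M f →
    sumOver (boxLists N (suc M)) f ≈ sumBelow R (suc N) (λ x → sumOver (boxLists N M) (f ∘ (x ∷_)))
  sumOver-boxLists N M f = begin
    sumOver (boxLists N (suc M)) f
      ≈⟨ sumOver-concatMap f (λ x → map (x ∷_) (boxLists N M)) (upTo (suc N)) ⟩
    sumOver (upTo (suc N)) (λ x → sumOver (map (x ∷_) (boxLists N M)) f)
      ≈⟨ sumOver-cong (upTo (suc N)) (λ x → reflexive (≡.cong (sumList R) (≡.sym (map-∘ (boxLists N M))))) ⟩
    sumOver (upTo (suc N)) (λ x → sumOver (boxLists N M) (f ∘ (x ∷_)))
      ≈⟨ sumOver-upTo (suc N) _ ⟩
    sumBelow R (suc N) (λ x → sumOver (boxLists N M) (f ∘ (x ∷_))) ∎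

  sumBelow-truncate : ∀ {K N} f (b : ℕ → Bool) → K ≤′ N →
    (∀ x → x < K → b x ≡ true) → (∀ x → K ≤ x → b x ≡ false) →
    sumBelow R N (λ x → if b x then f x else 0#) ≈ sumBelow R K f
  sumBelow-truncate {K} f b ≤′-refl        below above =
    sumBelow-cong-< K λ x x<K → reflexive (≡.cong (λ β → if β then f x else 0#) (below x x<K))
  sumBelow-truncate {K} f b (≤′-step {N} K≤N) below above = begin
    sumBelow R N (λ x → if b x then f x else 0#) + (if b N then f N else 0#)
      ≈⟨ +-cong (sumBelow-truncate f b K≤N below above)
                (reflexive (≡.cong (λ β → if β then f N else 0#) (above N (ℕₚ.≤′⇒≤ K≤N)))) ⟩
    sumBelow R K f + 0#  ≈⟨ +-identityʳ _ ⟩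
    sumBelow R K f       ∎

  -- Rows of both parities can thus be treated by one function: after a row is removed, the two
  -- pairs of labels are exchanged.
  ωEven-swap : ∀ a b c d l → ωEven R a b c d l ≈ ωOdd R c d a b l
  ωEven-swap a b c d []      = refl
  ωEven-swap a b c d (x ∷ l) = *-congˡ (sym (ωEven-swap c d a b l))

  -- Weighted count of sequences x₁ ≤ N, x₂ ≤ next x₁, …, x_M ≤ next x_{M-1}.
  chainSum : (ℕ → ℕ) → ℕ → ℕ → Carrier → Carrier → Carrier → Carrier → Carrier
  chainSum next N zero    a b c d = 1#
  chainSum next N (suc M) a b c d =
    sumBelow R (suc N) (λ x → rowWeight R a b x * chainSum next (next x) M c d a b)

  chainSum-zero : ∀ next M a b c d → next 0 ≡ 0 → chainSum next 0 M a b c d ≈ 1#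
  chainSum-zero next zero    a b c d p = refl
  chainSum-zero next (suc M) a b c d p = begin
    0# + 1# * chainSum next (next 0) M c d a b ≈⟨ trans (+-identityˡ _) (*-identityˡ _) ⟩
    chainSum next (next 0) M c d a b
      ≈⟨ reflexive (≡.cong (λ j → chainSum next j M c d a b) p) ⟩
    chainSum next 0 M c d a b                  ≈⟨ chainSum-zero next M c d a b p ⟩
    1#                                         ∎

  -- Both kinds of partitions are covered by one argument, since the rows `x` allowed after `y` are
  -- exactly those with `x ≤ next y`. The condition `next y ≤ y` keeps this range inside the box.
  module _ {_~_ : ℕ → ℕ → Set} (_~?_ : Decidable₂ _~_) (next : ℕ → ℕ)
           (next≤ : ∀ y → next y ≤ y) (~⇒≤ : ∀ {y x} → y ~ x → x ≤ next y)
           (≤⇒~ : ∀ {y x} → x ≤ next y → y ~ x) where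

    linkedSum : (List ℕ → Carrier) → List ℕ → Carrier
    linkedSum w l = if does (linked? _~?_ l) then w l else 0#

    linkedSum-tail : ∀ y N M a b c d → y ≤ N →
      sumOver (boxLists N M) (λ l → if does (linked? _~?_ (y ∷ l)) then ωOdd R a b c d l else 0#)
      ≈ chainSum next (next y) M a b c d

    linkedSum-cons : ∀ x N M a b c d → x ≤ N →
      sumOver (boxLists N M) (λ l → linkedSum (ωOdd R a b c d) (x ∷ l))
      ≈ rowWeight R a b x * chainSum next (next x) M c d a b

    linkedSum-tail y N zero    a b c d y≤N = +-identityʳ 1#
    linkedSum-tail y N (suc M) a b c d y≤N = begin
      sumOver (boxLists N (suc M)) (λ l → if does (linked? _~?_ (y ∷ l)) then ωOdd R a b c d l else 0#)
        ≈⟨ sumOver-boxLists N M _ ⟩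
      -- The decision for `y ∷ x ∷ l` reduces to this conjunction, so the test on the first pair can
      -- be separated from the rest.
      sumBelow R (suc N) (λ x → sumOver (boxLists N M)
        (λ l → if does (y ~? x) ∧ does (linked? _~?_ (x ∷ l)) then ωOdd R a b c d (x ∷ l) else 0#))
        ≈⟨ sumBelow-cong-< (suc N) (λ { x (s≤s x≤N) → step x (does (y ~? x)) x≤N }) ⟩
      sumBelow R (suc N) (λ x → if does (y ~? x) then rowWeight R a b x * chainSum next (next x) M c d a b else 0#)
        -- The test on `x` cuts the range from `suc N` down to `suc (next y)`.
        ≈⟨ sumBelow-truncate _ (λ x → does (y ~? x))
             (ℕₚ.≤⇒≤′ (s≤s (ℕₚ.≤-trans (next≤ y) y≤N)))
             (λ { x (s≤s x≤) → dec-true (y ~? x) (≤⇒~ x≤) })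
             (λ x <x → dec-false (y ~? x) (λ y~x → ℕₚ.<⇒≱ <x (~⇒≤ y~x))) ⟩
      chainSum next (next y) (suc M) a b c d ∎
      where
      step : ∀ x β → x ≤ N →
        sumOver (boxLists N M) (λ l → if β ∧ does (linked? _~?_ (x ∷ l)) then ωOdd R a b c d (x ∷ l) else 0#)
        ≈ (if β then rowWeight R a b x * chainSum next (next x) M c d a b else 0#)
      step x true  x≤N = linkedSum-cons x N M a b c d x≤N
      step x false x≤N = sumOver-0 (boxLists N M)

    linkedSum-cons x N M a b c d x≤N = begin
      sumOver (boxLists N M) (λ l → linkedSum (ωOdd R a b c d) (x ∷ l))
        ≈⟨ sumOver-cong (boxLists N M) (λ l → pull (does (linked? _~?_ (x ∷ l))) l) ⟩
      sumOver (boxLists N M) (λ l → rowWeight R a b x *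
        (if does (linked? _~?_ (x ∷ l)) then ωOdd R c d a b l else 0#))
        ≈⟨ *-distribˡ-sumOver _ _ (boxLists N M) ⟩
      rowWeight R a b x * sumOver (boxLists N M)
        (λ l → if does (linked? _~?_ (x ∷ l)) then ωOdd R c d a b l else 0#)
        ≈⟨ *-congˡ (linkedSum-tail x N M c d a b x≤N) ⟩
      rowWeight R a b x * chainSum next (next x) M c d a b ∎
      where
      pull : ∀ β l → (if β then ωOdd R a b c d (x ∷ l) else 0#)
                   ≈ rowWeight R a b x * (if β then ωOdd R c d a b l else 0#)
      pull true  l = *-congˡ (ωEven-swap a b c d l)
      pull false l = sym (zeroʳ _)

    linkedSum≈chainSum : ∀ N M a b c d →
      sumList R (map (ω² R a b c d) (filter (linked? _~?_) (boxLists N M))) ≈ chainSum next N M a b c d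
    linkedSum≈chainSum N zero    a b c d = +-identityʳ 1#
    linkedSum≈chainSum N (suc M) a b c d = begin
      sumOver (filter (linked? _~?_) (boxLists N (suc M))) (ωOdd R a b c d)
        ≈⟨ sumOver-filter (linked? _~?_) _ (boxLists N (suc M)) ⟩
      sumOver (boxLists N (suc M)) (linkedSum (ωOdd R a b c d))
        ≈⟨ sumOver-boxLists N M _ ⟩
      sumBelow R (suc N) (λ x → sumOver (boxLists N M) (λ l → linkedSum (ωOdd R a b c d) (x ∷ l)))
        ≈⟨ sumBelow-cong-< (suc N) (λ { x (s≤s x≤N) → linkedSum-cons x N M a b c d x≤N }) ⟩
      chainSum next N (suc M) a b c d ∎

  Φ≈chainSum : ∀ N M a b c d → Φ R N M a b c d ≈ chainSum id N M a b c d
  Φ≈chainSum = linkedSum≈chainSum (λ x y → x ≥? y) id (λ _ → ℕₚ.≤-refl) id id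

  -- `DistRel y x` amounts to `x ≤ pred y`. As `pred 0` is 0, a padding zero may be repeated
  -- although positive parts may not.
  Ψ≈chainSum : ∀ N M a b c d → Ψ R N M a b c d ≈ chainSum pred N M a b c d
  Ψ≈chainSum = linkedSum≈chainSum (λ x y → (y ≟ 0) ⊎-dec (y <? x)) pred (λ _ → ℕₚ.pred[n]≤n) to from
    where
    to : ∀ {y x} → DistRel y x → x ≤ pred y
    to (inj₁ ≡.refl)    = z≤n
    to (inj₂ (s≤s x≤y)) = x≤y
    from : ∀ {y x} → x ≤ pred y → DistRel y x
    from {zero}  z≤n = inj₁ ≡.refl
    from {suc y} x≤y = inj₂ (s≤s x≤y)

-- Generating functions in the variable that marks half the bound on the parts.

module ColumnSeries {ℓ₁ ℓ₂ : Level} (R : CommutativeRing ℓ₁ ℓ₂) (q : CommutativeRing.Carrier R) where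
  open CommutativeRing R hiding (zero)
  open PowerSeries R
  open QProducts R q
  open SemiringSolver commutativeSemiring using () renaming (solve to solveᵣ; _:+_ to _⊞_; _:*_ to _⊠_; _:=_ to _≔_)
  open SemiringSolver seriesSemiring using (solve; _:+_; _:*_; _:=_; con)
  open SetoidReasoning S.setoid

  -- As a fraction, (-xt; q)ᵢ (-abct; q)ₗ / ((abt; q)ⱼ (t; q)ₗ₊₁). The four factors produce the
  -- summation indices m₁, m₂, m₃, m₄ of the formula, in this order.
  P : ℕ → ℕ → ℕ → Carrier → Carrier → Carrier → Carrier → Series
  P i j l x a b c = E i x ⊛ (I j (a * b) ⊛ (E l (a * b * c) ⊛ I (suc l) 1#))

  -- With subscripts νμ, the coefficient of tᴺ in T L a b c is the sum of ω² over the partitions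
  -- with at most 2L+μ parts, all ≤ 2N+ν, in which no odd part is repeated (q = abcd).
  T₀₀ T₀₁ T₁₀ T₁₁ : ℕ → Carrier → Carrier → Carrier → Series
  T₀₀ L a b c = P L L L a a b c
  T₀₁ L a b c = P (suc L) (suc L) L a a b c
  T₁₀ zero    a b c = I 1 1#
  T₁₀ (suc L) a b c = const (1# + a) ⊛ P L (suc L) (suc L) (q * a) a b c
  T₁₁ L a b c = const (1# + a) ⊛ P L (suc L) L (q * a) a b c

  T₀₀-zero : ∀ a b c → T₀₀ 0 a b c ≋ I 1 1#
  T₀₀-zero a b c = begin
    E 0 a ⊛ (I 0 (a * b) ⊛ (E 0 (a * b * c) ⊛ I 1 1#))
      ≈⟨ S.*-cong (E-zero _) (S.*-cong (I-zero _) (S.*-congʳ (E-zero _))) ⟩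
    1ₛ ⊛ (1ₛ ⊛ (1ₛ ⊛ I 1 1#))
      ≈⟨ solve 1 (λ x → con 1 :* (con 1 :* (con 1 :* x)) := x) S.refl (I 1 1#) ⟩
    I 1 1# ∎

  const-1+ : ∀ x → const (1# + x) ≋ 1ₛ ⊕ const x
  const-1+ = const-+ 1#

  I-1#-suc : ∀ n → I (suc n) 1# ≋ I n q ⊕ 𝐭 ⊛ I (suc n) 1#
  I-1#-suc n = begin
    I (suc n) 1#                                   ≈⟨ I-sucˡ n 1# ⟩
    I n (q * 1#) ⊕ 1ₛ ⊛ (𝐭 ⊛ I (suc n) 1#)
      ≈⟨ S.+-cong (I-cong n (*-identityʳ q)) (S.*-identityˡ _) ⟩
    I n q ⊕ 𝐭 ⊛ I (suc n) 1#                       ∎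

  dilate-P : ∀ z i j l x a b c →
    dilate z (P i j l x a b c) ≋ E i (z * x) ⊛ (I j (z * (a * b)) ⊛ (E l (z * (a * b * c)) ⊛ I (suc l) (z * 1#)))
  dilate-P z i j l x a b c =
    S.trans (dilate-⊛ z _ _) (S.*-cong (dilate-E z i x)
      (S.trans (dilate-⊛ z _ _) (S.*-cong (dilate-I z j (a * b))
        (S.trans (dilate-⊛ z _ _) (S.*-cong (dilate-E z l (a * b * c)) (dilate-I z (suc l) 1#))))))

  -- The hypothesis is (1 - t) D = J, and 1 + A = (1 + A t) + A (1 - t).
  odd-step-algebra : ∀ A X G Y D J → D ≋ J ⊕ 𝐭 ⊛ D →
    (1ₛ ⊕ A) ⊛ (X ⊛ (G ⊛ (Y ⊛ D))) ≋ (X ⊕ A ⊛ (𝐭 ⊛ X)) ⊛ (G ⊛ (Y ⊛ D)) ⊕ A ⊛ (Y ⊛ (J ⊛ (X ⊛ G)))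
  odd-step-algebra A X G Y D J D-eq = begin
    (1ₛ ⊕ A) ⊛ (X ⊛ (G ⊛ (Y ⊛ D)))
      ≈⟨ solve 5 (λ a x g y d → (con 1 :+ a) :* (x :* (g :* (y :* d))) := x :* g :* y :* (d :+ a :* d)) S.refl A X G Y D ⟩
    X ⊛ G ⊛ Y ⊛ (D ⊕ A ⊛ D)
      ≈⟨ S.*-congˡ (S.+-congˡ (S.*-congˡ D-eq)) ⟩
    X ⊛ G ⊛ Y ⊛ (D ⊕ A ⊛ (J ⊕ 𝐭 ⊛ D))
      ≈⟨ solve 7 (λ a x g y d j t → x :* g :* y :* (d :+ a :* (j :+ t :* d)) :=
           (x :+ a :* (t :* x)) :* (g :* (y :* d)) :+ a :* (y :* (j :* (x :* g)))) S.refl A X G Y D J 𝐭 ⟩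
    (X ⊕ A ⊛ (𝐭 ⊛ X)) ⊛ (G ⊛ (Y ⊛ D)) ⊕ A ⊛ (Y ⊛ (J ⊛ (X ⊛ G))) ∎

  -- The hypotheses say (1 - t) D = J, (1 - B t) G = K and Y = (1 + B V t) Z. Writing 1 + B V t = (1
  -- - B t) + B (1 + V) t gives (1 - t) G Y D = K Z J + B t (1 + V) Z J G, which is `GYD`.
  -- Multiplying by X and adding A t X G Y D gives the claim.
  even-step-algebra : ∀ A B V X G K Y Z D J →
    D ≋ J ⊕ 𝐭 ⊛ D → G ≋ K ⊕ B ⊛ (𝐭 ⊛ G) → Y ≋ Z ⊕ B ⊛ V ⊛ (𝐭 ⊛ Z) →
    (X ⊕ A ⊛ (𝐭 ⊛ X)) ⊛ (G ⊛ (Y ⊛ D)) ≋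
      X ⊛ (K ⊛ (Z ⊛ J)) ⊕ 𝐭 ⊛ ((1ₛ ⊕ A) ⊛ (X ⊛ (G ⊛ (Y ⊛ D))) ⊕ B ⊛ ((1ₛ ⊕ V) ⊛ (Z ⊛ (J ⊛ (X ⊛ G)))))
  even-step-algebra A B V X G K Y Z D J D-eq G-eq Y-eq = begin
    (X ⊕ A ⊛ (𝐭 ⊛ X)) ⊛ (G ⊛ (Y ⊛ D))
      ≈⟨ solve 6 (λ a x g y d t → (x :+ a :* (t :* x)) :* (g :* (y :* d)) :=
           x :* (g :* (y :* d)) :+ a :* t :* (x :* (g :* (y :* d)))) S.refl A X G Y D 𝐭 ⟩
    X ⊛ (G ⊛ (Y ⊛ D)) ⊕ A ⊛ 𝐭 ⊛ (X ⊛ (G ⊛ (Y ⊛ D)))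
      ≈⟨ S.+-congʳ (S.*-congˡ GYD) ⟩
    X ⊛ (K ⊛ (Z ⊛ J) ⊕ 𝐭 ⊛ (G ⊛ (Y ⊛ D)) ⊕ B ⊛ 𝐭 ⊛ ((1ₛ ⊕ V) ⊛ (Z ⊛ (J ⊛ G)))) ⊕ A ⊛ 𝐭 ⊛ (X ⊛ (G ⊛ (Y ⊛ D)))
      ≈⟨ solve 8 (λ a b c x u v w t →
           x :* (u :+ t :* v :+ b :* t :* (c :* w)) :+ a :* t :* (x :* v) :=
           x :* u :+ t :* ((con 1 :+ a) :* (x :* v) :+ b :* (c :* (x :* w)))) S.refl
           A B (1ₛ ⊕ V) X (K ⊛ (Z ⊛ J)) (G ⊛ (Y ⊛ D)) (Z ⊛ (J ⊛ G)) 𝐭 ⟩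
    X ⊛ (K ⊛ (Z ⊛ J)) ⊕ 𝐭 ⊛ ((1ₛ ⊕ A) ⊛ (X ⊛ (G ⊛ (Y ⊛ D))) ⊕ B ⊛ ((1ₛ ⊕ V) ⊛ (X ⊛ (Z ⊛ (J ⊛ G)))))
      ≈⟨ S.+-congˡ (S.*-congˡ (S.+-congˡ (S.*-congˡ (S.*-congˡ
           (solve 4 (λ x z j g → x :* (z :* (j :* g)) := z :* (j :* (x :* g))) S.refl X Z J G))))) ⟩
    X ⊛ (K ⊛ (Z ⊛ J)) ⊕ 𝐭 ⊛ ((1ₛ ⊕ A) ⊛ (X ⊛ (G ⊛ (Y ⊛ D))) ⊕ B ⊛ ((1ₛ ⊕ V) ⊛ (Z ⊛ (J ⊛ (X ⊛ G))))) ∎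
    where
    GYD : G ⊛ (Y ⊛ D) ≋ K ⊛ (Z ⊛ J) ⊕ 𝐭 ⊛ (G ⊛ (Y ⊛ D)) ⊕ B ⊛ 𝐭 ⊛ ((1ₛ ⊕ V) ⊛ (Z ⊛ (J ⊛ G)))
    GYD = begin
      G ⊛ (Y ⊛ D)
        ≈⟨ S.*-congˡ (S.*-congˡ D-eq) ⟩
      G ⊛ (Y ⊛ (J ⊕ 𝐭 ⊛ D))
        ≈⟨ solve 5 (λ g y d j t → g :* (y :* (j :+ t :* d)) := g :* y :* j :+ t :* (g :* (y :* d))) S.refl G Y D J 𝐭 ⟩
      G ⊛ Y ⊛ J ⊕ 𝐭 ⊛ (G ⊛ (Y ⊛ D))
        ≈⟨ S.+-congʳ (S.*-congʳ (S.*-congˡ Y-eq)) ⟩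
      G ⊛ (Z ⊕ B ⊛ V ⊛ (𝐭 ⊛ Z)) ⊛ J ⊕ 𝐭 ⊛ (G ⊛ (Y ⊛ D))
        ≈⟨ solve 7 (λ g z b c j t w → g :* (z :+ b :* c :* (t :* z)) :* j :+ w :=
             g :* (z :* j) :+ (w :+ b :* t :* (c :* (z :* (j :* g))))) S.refl G Z B V J 𝐭 (𝐭 ⊛ (G ⊛ (Y ⊛ D))) ⟩
      G ⊛ (Z ⊛ J) ⊕ (𝐭 ⊛ (G ⊛ (Y ⊛ D)) ⊕ B ⊛ 𝐭 ⊛ (V ⊛ (Z ⊛ (J ⊛ G))))
        ≈⟨ S.+-congʳ (S.*-congʳ G-eq) ⟩
      (K ⊕ B ⊛ (𝐭 ⊛ G)) ⊛ (Z ⊛ J) ⊕ (𝐭 ⊛ (G ⊛ (Y ⊛ D)) ⊕ B ⊛ 𝐭 ⊛ (V ⊛ (Z ⊛ (J ⊛ G))))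
        ≈⟨ solve 8 (λ k b t g z j w c →
             (k :+ b :* (t :* g)) :* (z :* j) :+ (w :+ b :* t :* (c :* (z :* (j :* g)))) :=
             k :* (z :* j) :+ w :+ b :* t :* ((con 1 :+ c) :* (z :* (j :* g)))) S.refl
             K B 𝐭 G Z J (𝐭 ⊛ (G ⊛ (Y ⊛ D))) V ⟩
      K ⊛ (Z ⊛ J) ⊕ 𝐭 ⊛ (G ⊛ (Y ⊛ D)) ⊕ B ⊛ 𝐭 ⊛ ((1ₛ ⊕ V) ⊛ (Z ⊛ (J ⊛ G))) ∎

  module _ (a b c d : Carrier) (abcd≈q : a * b * c * d ≈ q) where

    -- This is why the family closes under the exchange of labels: replacing t by abt turns cd, cda
    -- and 1 into q, qa and ab, which are the parameters of the factors of the unswapped series.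
    dilate-swapped-P : ∀ i j l {x y} → a * b * x ≈ y →
      dilate (a * b) (P i j l x c d a) ≋ E i y ⊛ (I j q ⊛ (E l (q * a) ⊛ I (suc l) (a * b)))
    dilate-swapped-P i j l {x} x≈y = S.trans (dilate-P (a * b) i j l x c d a)
      (S.*-cong (E-cong i x≈y) (S.*-cong (I-cong j abcd≈q′)
        (S.*-cong (E-cong l (trans (sym (*-assoc _ _ _)) (*-congʳ abcd≈q′))) (I-cong (suc l) (*-identityʳ _)))))
      where
      abcd≈q′ : a * b * (c * d) ≈ q
      abcd≈q′ = trans (sym (*-assoc _ _ _)) abcd≈q

    q*-comm : a * b * (q * c) ≈ q * (a * b * c)
    q*-comm = solveᵣ 3 (λ p q c → p ⊠ (q ⊠ c) ≔ q ⊠ (p ⊠ c)) refl (a * b) q c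

    -- `L` and `l` are independent so that one identity serves both parities of the number of rows:
    -- `l` equal to `L` gives `T₁₁`, and `l` equal to `suc L` gives `T₁₀`.
    odd-step-P : ∀ L l → let X = E L (q * a) in
      const (1# + a) ⊛ P L (suc L) l (q * a) a b c ≋
        P (suc L) (suc L) l a a b c ⊕ const a ⊛ (E l (a * b * c) ⊛ (I l q ⊛ (X ⊛ I (suc L) (a * b))))
    odd-step-P L l = begin
      const (1# + a) ⊛ (X ⊛ (G ⊛ (Y ⊛ D)))      ≈⟨ S.*-congʳ (const-1+ a) ⟩
      (1ₛ ⊕ const a) ⊛ (X ⊛ (G ⊛ (Y ⊛ D)))      ≈⟨ odd-step-algebra (const a) X G Y D (I l q) (I-1#-suc l) ⟩
      (X ⊕ const a ⊛ (𝐭 ⊛ X)) ⊛ (G ⊛ (Y ⊛ D)) ⊕ const a ⊛ (Y ⊛ (I l q ⊛ (X ⊛ G)))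
        ≈⟨ S.+-congʳ (S.*-congʳ (E-sucˡ L a)) ⟨
      E (suc L) a ⊛ (G ⊛ (Y ⊛ D)) ⊕ const a ⊛ (Y ⊛ (I l q ⊛ (X ⊛ G))) ∎
      where
      X = E L (q * a)
      G = I (suc L) (a * b)
      Y = E l (a * b * c)
      D = I (suc l) 1#

    -- In terms of partitions: a part 2N+1 is either absent or occurs exactly once, as the first
    -- row. In the latter case it has weight a(ab)ᴺ, and the remaining rows have bound 2N and
    -- exchanged labels.
    T₁₁-rec : ∀ L → T₁₁ L a b c ≋ T₀₁ L a b c ⊕ const a ⊛ dilate (a * b) (T₀₀ L c d a)
    T₁₁-rec L = S.trans (odd-step-P L L) (S.+-congˡ (S.*-congˡ (S.sym (dilate-swapped-P L L L refl))))

    T₁₀-rec : ∀ L → T₁₀ (suc L) a b c ≋ T₀₀ (suc L) a b c ⊕ const a ⊛ dilate (a * b) (T₀₁ L c d a)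
    T₁₀-rec L = S.trans (odd-step-P L (suc L))
      (S.+-congˡ (S.*-congˡ (S.sym (dilate-swapped-P (suc L) (suc L) L refl))))

    even-step-P : ∀ L l → let Z = E l (q * (a * b * c)) in
      P (suc L) (suc L) (suc l) a a b c ≋
        dilate q (P L L l a a b c) ⊕ 𝐭 ⊛ (const (1# + a) ⊛ P L (suc L) (suc l) (q * a) a b c
          ⊕ const (a * b) ⊛ (const (1# + c) ⊛ (Z ⊛ (I (suc l) q ⊛ (E L (q * a) ⊛ I (suc L) (a * b))))))
    even-step-P L l = begin
      E (suc L) a ⊛ (G ⊛ (Y ⊛ D))
        ≈⟨ S.*-congʳ (E-sucˡ L a) ⟩
      (X ⊕ const a ⊛ (𝐭 ⊛ X)) ⊛ (G ⊛ (Y ⊛ D))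
        ≈⟨ even-step-algebra (const a) (const (a * b)) (const c) X G K Y Z D J (I-1#-suc (suc l))
             (I-sucˡ L (a * b)) (S.trans (E-sucˡ l (a * b * c)) (S.+-congˡ (S.*-congʳ (const-* (a * b) c)))) ⟩
      X ⊛ (K ⊛ (Z ⊛ J)) ⊕ 𝐭 ⊛ ((1ₛ ⊕ const a) ⊛ (X ⊛ (G ⊛ (Y ⊛ D)))
        ⊕ const (a * b) ⊛ ((1ₛ ⊕ const c) ⊛ (Z ⊛ (J ⊛ (X ⊛ G)))))
        ≈⟨ S.+-cong (S.trans (dilate-P q L L l a a b c)
                      (S.*-congˡ (S.*-congˡ (S.*-congˡ (I-cong (suc l) (*-identityʳ q))))))
             (S.*-congˡ (S.+-cong (S.*-congʳ (const-1+ a)) (S.*-congˡ (S.*-congʳ (const-1+ c))))) ⟨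
      dilate q (P L L l a a b c) ⊕ 𝐭 ⊛ (const (1# + a) ⊛ (X ⊛ (G ⊛ (Y ⊛ D)))
        ⊕ const (a * b) ⊛ (const (1# + c) ⊛ (Z ⊛ (J ⊛ (X ⊛ G))))) ∎
      where
      X = E L (q * a)
      G = I (suc L) (a * b)
      K = I L (q * (a * b))
      Y = E (suc l) (a * b * c)
      Z = E l (q * (a * b * c))
      D = I (suc (suc l)) 1#
      J = I (suc l) q

    dilate-scaled-swapped : ∀ i j l → dilate (a * b) (const (1# + c) ⊛ P i j l (q * c) c d a) ≋
      const (1# + c) ⊛ (E i (q * (a * b * c)) ⊛ (I j q ⊛ (E l (q * a) ⊛ I (suc l) (a * b))))
    dilate-scaled-swapped i j l = S.trans (dilate-⊛ (a * b) _ _)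
      (S.*-cong (dilate-const (a * b) (1# + c)) (dilate-swapped-P i j l q*-comm))

    -- In terms of partitions with bound 2N+2: the largest possible part occurs at least twice (the
    -- dilation by `q` removes two such rows), not at all, or exactly once. The three summands
    -- correspond to these cases in this order.
    T₀₀-rec : ∀ L → T₀₀ (suc L) a b c ≋ dilate q (T₀₀ L a b c) ⊕
      𝐭 ⊛ (T₁₀ (suc L) a b c ⊕ const (a * b) ⊛ dilate (a * b) (T₁₁ L c d a))
    T₀₀-rec L = S.trans (even-step-P L L)
      (S.+-congˡ (S.*-congˡ (S.+-congˡ (S.*-congˡ (S.sym (dilate-scaled-swapped L (suc L) L))))))

    T₀₁-rec : ∀ L → T₀₁ (suc L) a b c ≋ dilate q (T₀₁ L a b c) ⊕
      𝐭 ⊛ (T₁₁ (suc L) a b c ⊕ const (a * b) ⊛ dilate (a * b) (T₁₀ (suc L) c d a))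
    T₀₁-rec L = S.trans (even-step-P (suc L) L)
      (S.+-congˡ (S.*-congˡ (S.+-congˡ (S.*-congˡ (S.sym (dilate-scaled-swapped L (suc L) (suc L)))))))

    -- There are too few rows to remove two of them, so the dilated term is replaced by `1ₛ`, which
    -- accounts for the bound 0.
    T₀₀-rec-0 : T₀₀ 0 a b c ≋ 1ₛ ⊕ 𝐭 ⊛ T₁₀ 0 a b c
    T₀₀-rec-0 = S.trans (T₀₀-zero a b c) (S.trans (I-1#-suc 0) (S.+-congʳ (I-zero q)))

    T₀₁-rec-0 : T₀₁ 0 a b c ≋ 1ₛ ⊕ 𝐭 ⊛ (T₁₁ 0 a b c ⊕ const (a * b) ⊛ dilate (a * b) (T₁₀ 0 c d a))
    T₀₁-rec-0 = begin
      E 1 a ⊛ (G ⊛ (Y ⊛ D))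
        ≈⟨ S.*-congʳ (E-sucˡ 0 a) ⟩
      (X ⊕ const a ⊛ (𝐭 ⊛ X)) ⊛ (G ⊛ (Y ⊛ D))
        -- Here the factor `Y` is an empty product with nothing to split off, so V is 0 instead of
        -- `c`; K, Z and J are empty products as well.
        ≈⟨ even-step-algebra (const a) (const (a * b)) 0ₛ X G 1ₛ Y 1ₛ D 1ₛ
             (S.trans (I-1#-suc 0) (S.+-congʳ (I-zero q)))
             (S.trans (I-sucˡ 0 (a * b)) (S.+-congʳ (I-zero _)))
             (S.trans (E-zero _) (solve 2 (λ u t → con 1 := con 1 :+ u :* con 0 :* (t :* con 1)) S.refl (const (a * b)) 𝐭)) ⟩
      X ⊛ (1ₛ ⊛ (1ₛ ⊛ 1ₛ)) ⊕ 𝐭 ⊛ ((1ₛ ⊕ const a) ⊛ (X ⊛ (G ⊛ (Y ⊛ D)))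
        ⊕ const (a * b) ⊛ ((1ₛ ⊕ 0ₛ) ⊛ (1ₛ ⊛ (1ₛ ⊛ (X ⊛ G)))))
        ≈⟨ S.+-cong (S.trans (S.*-congʳ (E-zero _)) (solve 0 (con 1 :* (con 1 :* (con 1 :* con 1)) := con 1) S.refl))
             (S.*-congˡ (S.+-cong (S.*-congʳ (S.sym (const-1+ a))) (S.*-congˡ tail))) ⟩
      1ₛ ⊕ 𝐭 ⊛ (T₁₁ 0 a b c ⊕ const (a * b) ⊛ dilate (a * b) (I 1 1#)) ∎
      where
      X = E 0 (q * a)
      G = I 1 (a * b)
      Y = E 0 (a * b * c)
      D = I 1 1#
      tail : (1ₛ ⊕ 0ₛ) ⊛ (1ₛ ⊛ (1ₛ ⊛ (X ⊛ G))) ≋ dilate (a * b) (I 1 1#)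
      tail = begin
        (1ₛ ⊕ 0ₛ) ⊛ (1ₛ ⊛ (1ₛ ⊛ (X ⊛ G)))     ≈⟨ S.*-congˡ (S.*-congˡ (S.*-congˡ (S.*-congʳ (E-zero _)))) ⟩
        (1ₛ ⊕ 0ₛ) ⊛ (1ₛ ⊛ (1ₛ ⊛ (1ₛ ⊛ G)))
          ≈⟨ solve 1 (λ g → (con 1 :+ con 0) :* (con 1 :* (con 1 :* (con 1 :* g))) := g) S.refl G ⟩
        G                                      ≈⟨ I-cong 1 (*-identityʳ _) ⟨
        I 1 (a * b * 1#)                       ≈⟨ dilate-I (a * b) 1 1# ⟨
        dilate (a * b) (I 1 1#)                ∎

-- Generating functions in the number of pairs of rows.

double : ℕ → ℕ
double zero    = zero
double (suc n) = suc (suc (double n))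

module RowSeries {ℓ₁ ℓ₂ : Level} (R : CommutativeRing ℓ₁ ℓ₂) (q : CommutativeRing.Carrier R) where
  open CommutativeRing R hiding (zero)
  open PowerSeries R
  open BoxSums R
  open QProducts R q
  open QProductRecurrences R q
  open ColumnSeries R q
  open SemiringSolver commutativeSemiring using () renaming (solve to solveᵣ; _:+_ to _⊞_; _:*_ to _⊠_; _:=_ to _≔_)
  open SemiringSolver seriesSemiring using (solve; _:+_; _:*_; _:=_)
  open SetoidReasoning S.setoid
  open RingProperties ring using (-1*x≈-x)

  -- From here on `𝐭` marks pairs of rows, no longer pairs of columns. The recursion defining
  -- `double` exposes two rows of `chainSum` at each step.
  evens odds : (ℕ → ℕ) → ℕ → Carrier → Carrier → Carrier → Carrier → Series
  evens next N a b c d M = chainSum next N (double M) a b c d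
  odds  next N a b c d M = chainSum next N (suc (double M)) a b c d

  -- The case of a first row of length `suc N` is the last summand of `chainSum`. Splitting it off
  -- for the first row and then for the second returns to the original labels, two rows fewer; both
  -- splittings hold by reduction.
  evens-Φ-rec : ∀ N a b c d → let W = rowWeight R a b (suc N) ; W′ = rowWeight R c d (suc N) in
    evens id (suc N) a b c d ≋
      (evens id N a b c d ⊕ const W ⊛ (𝐭 ⊛ odds id N c d a b)) ⊕ const (W * W′) ⊛ (𝐭 ⊛ evens id (suc N) a b c d)
  evens-Φ-rec N a b c d zero = sym (trans
    (affine-zero (evens id N a b c d ⊕ const W ⊛ (𝐭 ⊛ odds id N c d a b)) (W * W′) (evens id (suc N) a b c d))
    (affine-zero (evens id N a b c d) W (odds id N c d a b)))
    where
    W  = rowWeight R a b (suc N)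
    W′ = rowWeight R c d (suc N)
  evens-Φ-rec N a b c d (suc M) = trans
    (solveᵣ 5 (λ x w y v z → x ⊞ w ⊠ (y ⊞ v ⊠ z) ≔ x ⊞ w ⊠ y ⊞ w ⊠ v ⊠ z) refl
      (evens id N a b c d (suc M)) W (odds id N c d a b M) W′ (evens id (suc N) a b c d M))
    (sym (trans
      (affine-suc (evens id N a b c d ⊕ const W ⊛ (𝐭 ⊛ odds id N c d a b)) (W * W′) (evens id (suc N) a b c d) M)
      (+-congʳ (affine-suc (evens id N a b c d) W (odds id N c d a b) M))))
    where
    W  = rowWeight R a b (suc N)
    W′ = rowWeight R c d (suc N)

  -- Removing one row from 2M+1 leaves 2M, with the same `M`, so the middle term carries no `𝐭`,
  -- unlike for an even number of rows.
  odds-Φ-rec : ∀ N a b c d → let W = rowWeight R a b (suc N) ; W′ = rowWeight R c d (suc N) in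
    odds id (suc N) a b c d ≋
      (odds id N a b c d ⊕ const W ⊛ evens id N c d a b) ⊕ const (W * W′) ⊛ (𝐭 ⊛ odds id (suc N) a b c d)
  odds-Φ-rec N a b c d zero = sym (affine-zero
    (odds id N a b c d ⊕ const (rowWeight R a b (suc N)) ⊛ evens id N c d a b) _ (odds id (suc N) a b c d))
  odds-Φ-rec N a b c d (suc M) = trans
    (solveᵣ 5 (λ x w y v z → x ⊞ w ⊠ (y ⊞ v ⊠ z) ≔ x ⊞ w ⊠ y ⊞ w ⊠ v ⊠ z) refl
      (odds id N a b c d (suc M)) W (evens id N c d a b (suc M)) W′ (odds id (suc N) a b c d M))
    (sym (trans
      (affine-suc (odds id N a b c d ⊕ const W ⊛ evens id N c d a b) (W * W′) (odds id (suc N) a b c d) M)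
      (+-congʳ (+-congˡ (const-⊛ W (evens id N c d a b) (suc M))))))
    where
    W  = rowWeight R a b (suc N)
    W′ = rowWeight R c d (suc N)

  -- After a row `suc N` the bound drops to `N`, so the term for two equal rows is absent. Otherwise
  -- the recurrence is that of Φ.
  evens-Ψ-rec : ∀ N a b c d → evens pred (suc N) a b c d ≋
    evens pred N a b c d ⊕ const (rowWeight R a b (suc N)) ⊛ (𝐭 ⊛ odds pred N c d a b)
  evens-Ψ-rec N a b c d zero    = sym (affine-zero (evens pred N a b c d) _ (odds pred N c d a b))
  evens-Ψ-rec N a b c d (suc M) = sym (affine-suc (evens pred N a b c d) _ (odds pred N c d a b) M)

  odds-Ψ-rec : ∀ N a b c d → odds pred (suc N) a b c d ≋
    odds pred N a b c d ⊕ const (rowWeight R a b (suc N)) ⊛ evens pred N c d a b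
  odds-Ψ-rec N a b c d M = sym (+-congˡ (const-⊛ _ (evens pred N c d a b) M))

  rowWeight-double : ∀ x y n → rowWeight R x y (double n) ≈ (x * y) ^ n
  rowWeight-double x y zero    = refl
  rowWeight-double x y (suc n) = trans (*-congˡ (*-congˡ (rowWeight-double x y n))) (sym (*-assoc _ _ _))

  rowWeight-suc-double : ∀ x y n → rowWeight R x y (suc (double n)) ≈ x * (x * y) ^ n
  rowWeight-suc-double x y n = *-congˡ (trans (rowWeight-double y x n) (^-cong n (*-comm y x)))

  -- The same two-dimensional array as `T`, read as a series in the other index.
  H₀₀ H₀₁ H₁₀ H₁₁ : ℕ → Carrier → Carrier → Carrier → Series
  H₀₀ n a b c L = T₀₀ L a b c n
  H₀₁ n a b c L = T₀₁ L a b c n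
  H₁₀ n a b c L = T₁₀ L a b c n
  H₁₁ n a b c L = T₁₁ L a b c n

  module _ {a b c d : Carrier} (abcd≈q : a * b * c * d ≈ q) where

    coeff-odd-step : ∀ n (f g : Series) →
      (f ⊕ const a ⊛ dilate (a * b) g) n ≈ f n + rowWeight R a b (suc (double n)) * g n
    coeff-odd-step n f g = +-congˡ (trans (const-⊛ a (dilate (a * b) g) n)
      (trans (sym (*-assoc _ _ _)) (*-congʳ (sym (rowWeight-suc-double a b n)))))

    coeff-even-step : ∀ n (f g h : Series) →
      (dilate q f ⊕ 𝐭 ⊛ (g ⊕ const (a * b) ⊛ dilate (a * b) h)) (suc n) ≈
        q ^ suc n * f (suc n) + (g n + rowWeight R a b (double (suc n)) * h n)
    coeff-even-step n f g h = +-congˡ (trans (𝐭⊛-suc _ n) (+-congˡ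
      (trans (const-⊛ (a * b) (dilate (a * b) h) n)
        (trans (sym (*-assoc _ _ _)) (*-congʳ (sym (rowWeight-double a b (suc n))))))))

    -- Coefficient `n` of the recurrences for `T`: passing from `suc L` to `L` becomes the factor
    -- `𝐭`, and the dilations become weights of rows.
    H₁₀-rec : ∀ n → H₁₀ n a b c ≋ H₀₀ n a b c ⊕ const (rowWeight R a b (suc (double n))) ⊛ (𝐭 ⊛ H₀₁ n c d a)
    H₁₀-rec n zero    = sym (trans (affine-zero (H₀₀ n a b c) _ (H₀₁ n c d a)) (T₀₀-zero a b c n))
    H₁₀-rec n (suc L) = trans (T₁₀-rec a b c d abcd≈q L n)
      (trans (coeff-odd-step n (T₀₀ (suc L) a b c) (T₀₁ L c d a))
        (sym (affine-suc (H₀₀ n a b c) _ (H₀₁ n c d a) L)))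

    H₁₁-rec : ∀ n → H₁₁ n a b c ≋ H₀₁ n a b c ⊕ const (rowWeight R a b (suc (double n))) ⊛ H₀₀ n c d a
    H₁₁-rec n L = trans (T₁₁-rec a b c d abcd≈q L n)
      (trans (coeff-odd-step n (T₀₁ L a b c) (T₀₀ L c d a))
        (+-congˡ (sym (const-⊛ _ (H₀₀ n c d a) L))))

    H₀₀-rec : ∀ n → H₀₀ (suc n) a b c ≋
      (H₁₀ n a b c ⊕ const (rowWeight R a b (double (suc n))) ⊛ (𝐭 ⊛ H₁₁ n c d a))
      ⊕ const (q ^ suc n) ⊛ (𝐭 ⊛ H₀₀ (suc n) a b c)
    H₀₀-rec n zero = trans (T₀₀-rec-0 a b c d abcd≈q (suc n))
      -- The summand `1ₛ` of the base recurrence contributes nothing at index `suc n`.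
      (trans (+-identityˡ _) (trans (𝐭⊛-suc (T₁₀ 0 a b c) n)
        (sym (trans (affine-zero (H₁₀ n a b c ⊕ const _ ⊛ (𝐭 ⊛ H₁₁ n c d a)) _ (H₀₀ (suc n) a b c))
          (affine-zero (H₁₀ n a b c) _ (H₁₁ n c d a))))))
    H₀₀-rec n (suc L) = trans (T₀₀-rec a b c d abcd≈q L (suc n))
      (trans (coeff-even-step n (T₀₀ L a b c) (T₁₀ (suc L) a b c) (T₁₁ L c d a))
        (trans (+-comm _ _)
          (sym (trans (affine-suc (H₁₀ n a b c ⊕ const _ ⊛ (𝐭 ⊛ H₁₁ n c d a)) _ (H₀₀ (suc n) a b c) L)
            (+-congʳ (affine-suc (H₁₀ n a b c) _ (H₁₁ n c d a) L))))))

    H₀₁-rec : ∀ n → H₀₁ (suc n) a b c ≋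
      (H₁₁ n a b c ⊕ const (rowWeight R a b (double (suc n))) ⊛ H₁₀ n c d a)
      ⊕ const (q ^ suc n) ⊛ (𝐭 ⊛ H₀₁ (suc n) a b c)
    H₀₁-rec n zero = trans (T₀₁-rec-0 a b c d abcd≈q (suc n))
      (trans (+-identityˡ _)
        (trans (𝐭⊛-suc _ n) (trans (+-congˡ (trans (const-⊛ (a * b) _ n)
          (trans (sym (*-assoc _ _ _)) (*-congʳ (sym (rowWeight-double a b (suc n)))))))
        (sym (affine-zero (H₁₁ n a b c ⊕ const _ ⊛ H₁₀ n c d a) _ (H₀₁ (suc n) a b c))))))
    H₀₁-rec n (suc L) = trans (T₀₁-rec a b c d abcd≈q L (suc n))
      (trans (coeff-even-step n (T₀₁ L a b c) (T₁₁ (suc L) a b c) (T₁₀ (suc L) c d a))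
        (trans (+-comm _ _)
          (sym (trans (affine-suc (H₁₁ n a b c ⊕ const _ ⊛ H₁₀ n c d a) _ (H₀₁ (suc n) a b c) L)
            (+-congʳ (+-congˡ (const-⊛ _ (H₁₀ n c d a) (suc L))))))))

  -- Absorbing and cancelling linear factors.

  factorˡ : ∀ {f f′ X Y h w w′} → Y ≋ X ⊕ const w ⊛ (𝐭 ⊛ Y) → X ≋ f ⊛ h →
    f′ ≋ f ⊕ const w′ ⊛ (𝐭 ⊛ f′) → w ≈ w′ → Y ≋ f′ ⊛ h
  factorˡ {f} {f′} {X} {Y} {h} {w} {w′} Y-rec X-eq f′-rec w≈w′ = unique-fixpoint w X Y-rec (begin
    f′ ⊛ h                               ≈⟨ S.*-congʳ f′-rec ⟩
    (f ⊕ const w′ ⊛ (𝐭 ⊛ f′)) ⊛ h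
      ≈⟨ solve 5 (λ f w t g h → (f :+ w :* (t :* g)) :* h := f :* h :+ w :* (t :* (g :* h))) S.refl f (const w′) 𝐭 f′ h ⟩
    f ⊛ h ⊕ const w′ ⊛ (𝐭 ⊛ (f′ ⊛ h))
      ≈⟨ S.+-cong X-eq (S.*-congʳ (const-cong w≈w′)) ⟨
    X ⊕ const w ⊛ (𝐭 ⊛ (f′ ⊛ h)) ∎)

  -- Dividing X = f h by 1 - w t may change either factor. At odd widths the left factor `I` takes
  -- the division, since `H` forbids repeated odd rows; at even widths it is already part of the
  -- recurrence for `H`.
  factorʳ : ∀ {f h k X Y w w′} → Y ≋ X ⊕ const w ⊛ (𝐭 ⊛ Y) → X ≋ f ⊛ h →
    k ≋ h ⊕ const w′ ⊛ (𝐭 ⊛ k) → w ≈ w′ → Y ≋ f ⊛ k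
  factorʳ {f} {h} {k} Y-rec X-eq k-rec w≈w′ =
    S.trans (factorˡ Y-rec (S.trans X-eq (S.*-comm f h)) k-rec w≈w′) (S.*-comm k f)

  -- The step from one width to the next is linear over series, so a common factor passes through
  -- it.
  gather₁ : ∀ {f x y h k X Y} → X ≋ f ⊛ h → Y ≋ f ⊛ k → X ⊕ x ⊛ (y ⊛ Y) ≋ f ⊛ (h ⊕ x ⊛ (y ⊛ k))
  gather₁ {f} {x} {y} {h} {k} X-eq Y-eq = S.trans (S.+-cong X-eq (S.*-congˡ (S.*-congˡ Y-eq)))
    (solve 5 (λ f x y h k → f :* h :+ x :* (y :* (f :* k)) := f :* (h :+ x :* (y :* k))) S.refl f x y h k)

  gather₀ : ∀ {f x h k X Y} → X ≋ f ⊛ h → Y ≋ f ⊛ k → X ⊕ x ⊛ Y ≋ f ⊛ (h ⊕ x ⊛ k)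
  gather₀ {f} {x} {h} {k} X-eq Y-eq = S.trans (S.+-cong X-eq (S.*-congˡ Y-eq))
    (solve 4 (λ f x h k → f :* h :+ x :* (f :* k) := f :* (h :+ x :* k)) S.refl f x h k)

  -- Needed for width 0, where only the empty partition counts, whatever the number of rows.
  P-constant-term : ∀ i j l x a b c → P i j l x a b c 0 ≈ 1#
  P-constant-term i j l x a b c = trans
    (*-cong (E-constant-term i x) (*-cong (I-constant-term j (a * b))
      (*-cong (E-constant-term l (a * b * c)) (I-constant-term (suc l) 1#))))
    (trans (*-identityˡ _) (trans (*-identityˡ _) (*-identityˡ _)))

  -- In fractions, Y = X / (1 - w t) while f′ = (1 - w t) f. The sign is encoded by `w + w′ ≈ 0#`,
  -- so the series need no subtraction.
  divide-step : ∀ {f f′ X Y w w′} → Y ≋ X ⊕ const w ⊛ (𝐭 ⊛ Y) →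
    f′ ≋ f ⊕ const w′ ⊛ (𝐭 ⊛ f) → w + w′ ≈ 0# → f ⊛ X ≋ f′ ⊛ Y
  divide-step {f} {f′} {X} {Y} {w} {w′} Y-rec f′-rec w+w′≈0 = S.sym (begin
    f′ ⊛ Y                                                  ≈⟨ S.*-congʳ f′-rec ⟩
    (f ⊕ const w′ ⊛ (𝐭 ⊛ f)) ⊛ Y
      ≈⟨ solve 4 (λ f w t y → (f :+ w :* (t :* f)) :* y := f :* (y :+ w :* (t :* y))) S.refl f (const w′) 𝐭 Y ⟩
    f ⊛ (Y ⊕ const w′ ⊛ (𝐭 ⊛ Y))                            ≈⟨ S.*-congˡ (S.+-congʳ Y-rec) ⟩
    f ⊛ (X ⊕ const w ⊛ (𝐭 ⊛ Y) ⊕ const w′ ⊛ (𝐭 ⊛ Y))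
      ≈⟨ solve 6 (λ f x w w′ t y → f :* (x :+ w :* (t :* y) :+ w′ :* (t :* y)) := f :* (x :+ (w :+ w′) :* (t :* y)))
           S.refl f X (const w) (const w′) 𝐭 Y ⟩
    f ⊛ (X ⊕ (const w ⊕ const w′) ⊛ (𝐭 ⊛ Y))
      ≈⟨ S.*-congˡ (S.+-congˡ (S.*-congʳ (S.trans (S.sym (const-+ w w′)) (S.trans (const-cong w+w′≈0) const-0)))) ⟩
    f ⊛ (X ⊕ 0ₛ ⊛ (𝐭 ⊛ Y))                                  ≈⟨ S.*-congˡ (S.+-congˡ (S.zeroˡ (𝐭 ⊛ Y))) ⟩
    f ⊛ (X ⊕ 0ₛ)                                            ≈⟨ S.*-congˡ (S.+-identityʳ X) ⟩
    f ⊛ X                                                   ∎)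
    where
    const-0 : const 0# ≋ 0ₛ
    const-0 zero    = refl
    const-0 (suc n) = refl

  xy-1xy≈0 : ∀ x y → x * y + (- 1#) * x * y ≈ 0#
  xy-1xy≈0 x y = trans (+-congˡ (trans (*-assoc _ _ _) (-1*x≈-x (x * y)))) (-‿inverseʳ (x * y))

  -- Closed forms of the row series at every width.

  module _ (e : Carrier) where

    -- The recurrences alternate between (a, b, c, d) and (c, d, a, b). Both have the same products
    -- `q` and `e`, but only up to `≈`; hence `q` and `e` are fixed and the labels vary subject to
    -- two equations.
    module Weights {a b c d : Carrier} (abcd≈q : a * b * c * d ≈ q) (ac≈e : a * c ≈ e) where

      cdab≈q : c * d * a * b ≈ q
      cdab≈q = trans (solveᵣ 4 (λ a b c d → c ⊠ d ⊠ a ⊠ b ≔ a ⊠ b ⊠ c ⊠ d) refl a b c d) abcd≈q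

      ca≈e : c * a ≈ e
      ca≈e = trans (*-comm c a) ac≈e

      ab^*cd^ : ∀ n → (a * b) ^ n * (c * d) ^ n ≈ q ^ n
      ab^*cd^ n = trans (sym (*-^ _ _ n)) (^-cong n (trans (sym (*-assoc _ _ _)) abcd≈q))

      rowPair-odd : ∀ n → rowWeight R a b (suc (double n)) * rowWeight R c d (suc (double n)) ≈ e * q ^ n
      rowPair-odd n = trans (*-cong (rowWeight-suc-double a b n) (rowWeight-suc-double c d n))
        (trans (solveᵣ 4 (λ a u c v → a ⊠ u ⊠ (c ⊠ v) ≔ a ⊠ c ⊠ (u ⊠ v)) refl a ((a * b) ^ n) c ((c * d) ^ n))
          (*-cong ac≈e (ab^*cd^ n)))

      rowPair-even : ∀ n → rowWeight R a b (double n) * rowWeight R c d (double n) ≈ q ^ n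
      rowPair-even n = trans (*-cong (rowWeight-double a b n) (rowWeight-double c d n)) (ab^*cd^ n)

    mutual
      -- Induction on the width, for both parities of the number of rows at once, because removing
      -- one row exchanges them. Each odd width adds a factor 1 / (1 - e qⁿ t) to `I`, for pairs of
      -- equal odd rows.
      evens-double : ∀ n {a b c d} → a * b * c * d ≈ q → a * c ≈ e →
        evens id (double n) a b c d ≋ I n e ⊛ H₀₀ n a b c
      evens-double zero {a} {b} {c} {d} abcd ac M = trans (chainSum-zero id (double M) a b c d ≡.refl) (sym
        (trans (S.*-congʳ (I-zero e) M) (trans (⊛-identityˡ (H₀₀ 0 a b c) M) (P-constant-term M M M a a b c))))
      evens-double (suc n) abcd ac = factorʳ
        (evens-Φ-rec (suc (double n)) _ _ _ _)
        (gather₁ (evens-suc-double n abcd ac) (odds-suc-double n cdab≈q ca≈e))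
        (H₀₀-rec abcd n) (rowPair-even (suc n))
        where open Weights abcd ac

      odds-double : ∀ n {a b c d} → a * b * c * d ≈ q → a * c ≈ e →
        odds id (double n) a b c d ≋ I n e ⊛ H₀₁ n a b c
      odds-double zero {a} {b} {c} {d} abcd ac M = trans (chainSum-zero id (suc (double M)) a b c d ≡.refl) (sym
        (trans (S.*-congʳ (I-zero e) M) (trans (⊛-identityˡ (H₀₁ 0 a b c) M) (P-constant-term (suc M) (suc M) M a a b c))))
      odds-double (suc n) abcd ac = factorʳ
        (odds-Φ-rec (suc (double n)) _ _ _ _)
        (gather₀ (odds-suc-double n abcd ac) (evens-suc-double n cdab≈q ca≈e))
        (H₀₁-rec abcd n) (rowPair-even (suc n))
        where open Weights abcd ac

      evens-suc-double : ∀ n {a b c d} → a * b * c * d ≈ q → a * c ≈ e →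
        evens id (suc (double n)) a b c d ≋ I (suc n) e ⊛ H₁₀ n a b c
      evens-suc-double n abcd ac = factorˡ
        (evens-Φ-rec (double n) _ _ _ _)
        (S.trans (gather₁ (evens-double n abcd ac) (odds-double n cdab≈q ca≈e)) (S.*-congˡ (S.sym (H₁₀-rec abcd n))))
        (I-sucʳ n e) (rowPair-odd n)
        where open Weights abcd ac

      odds-suc-double : ∀ n {a b c d} → a * b * c * d ≈ q → a * c ≈ e →
        odds id (suc (double n)) a b c d ≋ I (suc n) e ⊛ H₁₁ n a b c
      odds-suc-double n abcd ac = factorˡ
        (odds-Φ-rec (double n) _ _ _ _)
        (S.trans (gather₀ (odds-double n abcd ac) (evens-double n cdab≈q ca≈e)) (S.*-congˡ (S.sym (H₁₁-rec abcd n))))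
        (I-sucʳ n e) (rowPair-odd n)
        where open Weights abcd ac

    -- (t q; q)ᵢ (t e; q)ⱼ
    D : ℕ → ℕ → Series
    D i j = E i (- 1# * q) ⊛ E j (- 1# * e)

    D-sucˡ : ∀ i j → D (suc i) j ≋ D i j ⊕ const (- 1# * q * q ^ i) ⊛ (𝐭 ⊛ D i j)
    D-sucˡ i j = S.trans (S.*-congʳ (E-sucʳ i _))
      (solve 4 (λ f w t g → (f :+ w :* (t :* f)) :* g := f :* g :+ w :* (t :* (f :* g))) S.refl
        (E i _) (const _) 𝐭 (E j _))

    D-sucʳ : ∀ i j → D i (suc j) ≋ D i j ⊕ const (- 1# * e * q ^ j) ⊛ (𝐭 ⊛ D i j)
    D-sucʳ i j = S.trans (S.*-congˡ (E-sucʳ j _))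
      (solve 4 (λ f w t g → g :* (f :+ w :* (t :* f)) := g :* f :+ w :* (t :* (g :* f))) S.refl
        (E j _) (const _) 𝐭 (E i _))

    D-zero : D 0 0 ≋ 1ₛ
    D-zero = S.trans (S.*-cong (E-zero _) (E-zero _)) (S.*-identityˡ 1ₛ)

    mutual
      -- The recurrences of Ψ and Φ apply the same linear operator, after which only Φ is divided by
      -- 1 - w t. So the quotient `D` gains exactly that factor at each width: in its first product
      -- at even widths, in its second at odd ones.
      evens-pred-double : ∀ n {a b c d} → a * b * c * d ≈ q → a * c ≈ e →
        evens pred (double n) a b c d ≋ D n n ⊛ evens id (double n) a b c d
      evens-pred-double zero {a} {b} {c} {d} abcd ac M = trans (chainSum-zero pred (double M) a b c d ≡.refl) (sym
        (trans (S.*-congʳ D-zero M) (trans (⊛-identityˡ (evens id 0 a b c d) M) (chainSum-zero id (double M) a b c d ≡.refl))))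
      evens-pred-double (suc n) abcd ac = S.trans (evens-Ψ-rec (suc (double n)) _ _ _ _)
        (S.trans (gather₁ (evens-pred-suc-double n abcd ac) (odds-pred-suc-double n cdab≈q ca≈e))
          (divide-step (evens-Φ-rec (suc (double n)) _ _ _ _) (D-sucˡ n (suc n))
            (trans (+-congʳ (rowPair-even (suc n))) (xy-1xy≈0 q (q ^ n)))))
        where open Weights abcd ac

      odds-pred-double : ∀ n {a b c d} → a * b * c * d ≈ q → a * c ≈ e →
        odds pred (double n) a b c d ≋ D n n ⊛ odds id (double n) a b c d
      odds-pred-double zero {a} {b} {c} {d} abcd ac M = trans (chainSum-zero pred (suc (double M)) a b c d ≡.refl) (sym
        (trans (S.*-congʳ D-zero M) (trans (⊛-identityˡ (odds id 0 a b c d) M) (chainSum-zero id (suc (double M)) a b c d ≡.refl))))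
      odds-pred-double (suc n) abcd ac = S.trans (odds-Ψ-rec (suc (double n)) _ _ _ _)
        (S.trans (gather₀ (odds-pred-suc-double n abcd ac) (evens-pred-suc-double n cdab≈q ca≈e))
          (divide-step (odds-Φ-rec (suc (double n)) _ _ _ _) (D-sucˡ n (suc n))
            (trans (+-congʳ (rowPair-even (suc n))) (xy-1xy≈0 q (q ^ n)))))
        where open Weights abcd ac

      evens-pred-suc-double : ∀ n {a b c d} → a * b * c * d ≈ q → a * c ≈ e →
        evens pred (suc (double n)) a b c d ≋ D n (suc n) ⊛ evens id (suc (double n)) a b c d
      evens-pred-suc-double n abcd ac = S.trans (evens-Ψ-rec (double n) _ _ _ _)
        (S.trans (gather₁ (evens-pred-double n abcd ac) (odds-pred-double n cdab≈q ca≈e))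
          (divide-step (evens-Φ-rec (double n) _ _ _ _) (D-sucʳ n n)
            (trans (+-congʳ (rowPair-odd n)) (xy-1xy≈0 e (q ^ n)))))
        where open Weights abcd ac

      odds-pred-suc-double : ∀ n {a b c d} → a * b * c * d ≈ q → a * c ≈ e →
        odds pred (suc (double n)) a b c d ≋ D n (suc n) ⊛ odds id (suc (double n)) a b c d
      odds-pred-suc-double n abcd ac = S.trans (odds-Ψ-rec (double n) _ _ _ _)
        (S.trans (gather₀ (odds-pred-double n abcd ac) (evens-pred-double n cdab≈q ca≈e))
          (divide-step (odds-Φ-rec (double n) _ _ _ _) (D-sucʳ n n)
            (trans (+-congʳ (rowPair-odd n)) (xy-1xy≈0 e (q ^ n)))))
        where open Weights abcd ac

-- Parity, halving and exponents of Q.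

data HalfView : ℕ → Set where
  even : ∀ k → HalfView (double k)
  odd  : ∀ k → HalfView (suc (double k))

halfView : ∀ n → HalfView n
halfView zero = even zero
halfView (suc n) with halfView n
... | even k = odd k
... | odd k  = even (suc k)

2*n≡double : ∀ n → 2 ℕ.* n ≡ double n
2*n≡double zero    = ≡.refl
2*n≡double (suc n) = ≡.cong suc (≡.trans (ℕₚ.+-suc n (n ℕ.+ 0)) (≡.cong suc (2*n≡double n)))

double/2 : ∀ n → double n / 2 ≡ n
double/2 n = ≡.trans (≡.cong (_/ 2) (≡.trans (≡.sym (2*n≡double n)) (ℕₚ.*-comm 2 n))) (m*n/n≡m n 2)

suc-double/2 : ∀ n → suc (double n) / 2 ≡ n
suc-double/2 n = ≡.trans (≡.cong (λ k → suc k / 2) (≡.sym (2*n≡double n)))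
  (≡.trans (+-distrib-/-∣ʳ 1 {2 ℕ.* n} (m∣m*n n)) (≡.trans (≡.cong (_/ 2) (2*n≡double n)) (double/2 n)))

double-∸ : ∀ m k → double m ∸ 2 ℕ.* k ≡ double (m ∸ k)
double-∸ m k = ≡.trans (≡.cong (double m ∸_) (2*n≡double k)) (go m k)
  where
  go : ∀ m k → double m ∸ double k ≡ double (m ∸ k)
  go m       zero    = ≡.refl
  go zero    (suc k) = ≡.refl
  go (suc m) (suc k) = go m k

-- The bound on `k` matters: for larger `k` the left side truncates to 0 but the right side is 1.
suc-double-∸ : ∀ {m k} → k ≤ m → suc (double m) ∸ 2 ℕ.* k ≡ suc (double (m ∸ k))
suc-double-∸ {m} {k} k≤m = ≡.trans (≡.cong (suc (double m) ∸_) (2*n≡double k)) (go k≤m)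
  where
  go : ∀ {m k} → k ≤ m → suc (double m) ∸ double k ≡ suc (double (m ∸ k))
  go z≤n       = ≡.refl
  go (s≤s k≤m) = go k≤m

-- Pairs from a disjoint union lie in the first part, in the second, or have one element in each.
[k+j]C2 : ∀ k j → (k ℕ.+ j) C 2 ≡ k C 2 ℕ.+ j C 2 ℕ.+ k ℕ.* j
[k+j]C2 zero    j = ≡.sym (ℕₚ.+-identityʳ (j C 2))
[k+j]C2 (suc k) j = begin
  suc (k ℕ.+ j) C 2                                 ≡⟨ suc-C-2 (k ℕ.+ j) ⟩
  k ℕ.+ j ℕ.+ (k ℕ.+ j) C 2                         ≡⟨ ≡.cong (k ℕ.+ j ℕ.+_) ([k+j]C2 k j) ⟩
  k ℕ.+ j ℕ.+ (k C 2 ℕ.+ j C 2 ℕ.+ k ℕ.* j)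
    ≡⟨ solve 5 (λ k j u v w → k :+ j :+ (u :+ v :+ w) := (k :+ u :+ v) :+ (j :+ w)) ≡.refl k j (k C 2) (j C 2) (k ℕ.* j) ⟩
  k ℕ.+ k C 2 ℕ.+ j C 2 ℕ.+ (j ℕ.+ k ℕ.* j)          ≡⟨ ≡.cong (λ x → x ℕ.+ j C 2 ℕ.+ suc k ℕ.* j) (suc-C-2 k) ⟨
  suc k C 2 ℕ.+ j C 2 ℕ.+ suc k ℕ.* j                ∎
  where
  open ≡.≡-Reasoning
  open +-*-Solver

-- With j = m - k the exponent of the formula is the one that the product of two q-Pochhammer
-- symbols produces: C(k, 2) and C(j, 2) from the binomial theorem, and `k` from the argument Q of
-- the first symbol.
Ψ-exponent : ∀ k j → (k ℕ.* (k ℕ.+ 1) ℕ.+ (k ℕ.+ j) C 2) ∸ (k ℕ.* (k ℕ.+ j)) ≡ k ℕ.+ k C 2 ℕ.+ j C 2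
Ψ-exponent k j = ≡.trans (≡.cong (_∸ k ℕ.* (k ℕ.+ j)) (≡.trans (≡.cong (k ℕ.* (k ℕ.+ 1) ℕ.+_) ([k+j]C2 k j))
    (solve 4 (λ k j u v → k :* (k :+ con 1) :+ (u :+ v :+ k :* j) := k :+ u :+ v :+ k :* (k :+ j)) ≡.refl k j (k C 2) (j C 2))))
  (ℕₚ.m+n∸n≡m (k ℕ.+ k C 2 ℕ.+ j C 2) (k ℕ.* (k ℕ.+ j)))
  where open +-*-Solver

-- Matching the closed forms with the stated sums.

module Conversion {ℓ₁ ℓ₂ : Level} (R : CommutativeRing ℓ₁ ℓ₂) (a b c d : CommutativeRing.Carrier R) where
  open CommutativeRing R hiding (zero)
  open PowerSeries R
  open BoxSums R
  open SemiringSolver commutativeSemiring using (solve; _:+_; _:*_; _:=_; con)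
  open SetoidReasoning setoid

  Q e : Carrier
  Q = a * b * c * d
  e = a * c

  open QProducts R Q
  open ColumnSeries R Q
  open RowSeries R Q

  -- The summand of `ΦRHS` with `L` in place of `M ∸ k`, arranged identically so that the two agree
  -- by reduction.
  ΦTerm : ℕ → ℕ → ℕ → ℕ → ℕ → ℕ → ℕ → Carrier
  ΦTerm L ν μ m₁ m₂ m₃ m₄ =
      qbin R Q (L ℕ.+ m₄) m₄
    * qbin R Q ((L ℕ.+ μ) ∸ ν) m₁
    * (1# + a * nat R ν) * pow R a m₁ * pow R Q ((m₁ ℕ.+ ν) C 2)
    * qbin R Q (((L ℕ.+ μ) ∸ 1) ℕ.+ m₂) m₂ * pow R (a * b) m₂
    * qbin R Q L m₃ * pow R (a * b * c) m₃ * pow R Q (m₃ C 2)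

  ΦInner : ℕ → ℕ → ℕ → ℕ → Carrier
  ΦInner N L ν μ =
    sumBelow R (suc N) (λ m₁ → sumBelow R (suc N) (λ m₂ →
    sumBelow R (suc N) (λ m₃ → sumBelow R (suc N) (λ m₄ →
      if (m₁ ℕ.+ m₂ ℕ.+ m₃ ℕ.+ m₄) ≡ᵇ N then ΦTerm L ν μ m₁ m₂ m₃ m₄ else 0#))))

  1^n≈1 : ∀ n → 1# ^ n ≈ 1#
  1^n≈1 zero    = refl
  1^n≈1 (suc n) = trans (*-identityˡ _) (1^n≈1 n)

  -- The indices `i` and `j` are variables tied to the truncated differences by equations, as these
  -- differences need not reduce for a variable `L`. The first factor `f` is left abstract to carry
  -- the scalar 1 + aν.
  inner : ∀ N L ν μ {i j} f → i ≡ (L ℕ.+ μ) ∸ ν → j ≡ (L ℕ.+ μ) ∸ 1 →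
    (∀ m → f m ≈ qbin R Q i m * ((1# + a * nat R ν) * a ^ m * Q ^ ((m ℕ.+ ν) C 2))) →
    (f ⊛ (I (suc j) (a * b) ⊛ (E L (a * b * c) ⊛ I (suc L) 1#))) N ≈ ΦInner N L ν μ
  inner N L ν μ {j = j} f ≡.refl ≡.refl f-eq =
    ⊛-as-quadruple-sum f (I (suc j) (a * b)) (E L (a * b * c)) (I (suc L) 1#) N (ΦTerm L ν μ)
    λ m₁ m₂ m₃ m₄ → trans (*-cong (f-eq m₁) (*-congˡ (*-congˡ (trans (*-congˡ (1^n≈1 m₄)) (*-identityʳ _)))))
      (rearrange _ _ _ _ _ _ _ _ _ _)
    where
    rearrange : ∀ w u s p r v x y i z →
      u * (s * p * r) * (v * x * (y * (i * z) * w)) ≈ w * u * s * p * r * v * x * y * z * i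
    rearrange w u s p r v x y i z = trans
      (*-congˡ (solve 6 (λ w v x y i z → v :* x :* (y :* (i :* z) :* w) := w :* (v :* x :* y :* z :* i)) refl w v x y i z))
      (trans (solve 6 (λ w u s p r h → u :* (s :* p :* r) :* (w :* h) := w :* u :* s :* p :* r :* h) refl w u s p r _)
        (solve 6 (λ h v x y z i → h :* (v :* x :* y :* z :* i) := h :* v :* x :* y :* z :* i) refl _ v x y z i))

  linearFactor₀ : ∀ n m → E n a m ≈ qbin R Q n m * ((1# + a * nat R 0) * a ^ m * Q ^ ((m ℕ.+ 0) C 2))
  linearFactor₀ n m rewrite ℕₚ.+-identityʳ m = *-congˡ (solve 3
    (λ a p r → r :* p := (con 1 :+ a :* con 0) :* p :* r) refl a (a ^ m) (Q ^ (m C 2)))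

  -- The shift of `a` to Qa supplies the extra Qᵐ that turns C(m, 2) into C(m+1, 2).
  linearFactor₁ : ∀ n m → (1# + a) * E n (Q * a) m ≈ qbin R Q n m * ((1# + a * nat R 1) * a ^ m * Q ^ ((m ℕ.+ 1) C 2))
  linearFactor₁ n m rewrite ℕₚ.+-comm m 1 = begin
    (1# + a) * (qbin R Q n m * (Q ^ (m C 2) * (Q * a) ^ m))
      ≈⟨ *-congˡ (*-congˡ (*-congˡ (*-^ Q a m))) ⟩
    (1# + a) * (qbin R Q n m * (Q ^ (m C 2) * (Q ^ m * a ^ m)))
      ≈⟨ solve 5 (λ a b r s p → (con 1 :+ a) :* (b :* (r :* (s :* p))) := b :* ((con 1 :+ a :* (con 1 :+ con 0)) :* p :* (s :* r)))
           refl a (qbin R Q n m) (Q ^ (m C 2)) (Q ^ m) (a ^ m) ⟩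
    qbin R Q n m * ((1# + a * (1# + 0#)) * a ^ m * (Q ^ m * Q ^ (m C 2)))
      ≈⟨ *-congˡ (*-congˡ (trans (reflexive (≡.cong (Q ^_) (suc-C-2 m))) (^-+ Q m (m C 2)))) ⟨
    qbin R Q n m * ((1# + a * (1# + 0#)) * a ^ m * Q ^ (suc m C 2)) ∎

  scaled-P : ∀ s i j l x N → (const s ⊛ P i j l x a b c) N ≈
    ((λ m → s * E i x m) ⊛ (I j (a * b) ⊛ (E l (a * b * c) ⊛ I (suc l) 1#))) N
  scaled-P s i j l x N = trans (const-⊛ s (P i j l x a b c) N) (sym (scaled-⊛ s (E i x) _ N))

  H₀₀-inner : ∀ N L → H₀₀ N a b c (suc L) ≈ ΦInner N (suc L) 0 0
  H₀₀-inner N L = inner N (suc L) 0 0 (E (suc L) a)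
    (≡.cong suc (≡.sym (ℕₚ.+-identityʳ L))) (≡.sym (ℕₚ.+-identityʳ L)) (linearFactor₀ (suc L))

  H₀₁-inner : ∀ N L → H₀₁ N a b c L ≈ ΦInner N L 0 1
  H₀₁-inner N L = inner N L 0 1 (E (suc L) a)
    (ℕₚ.+-comm 1 L) (≡.sym (ℕₚ.m+n∸n≡m L 1)) (linearFactor₀ (suc L))

  H₁₀-inner : ∀ N L → H₁₀ N a b c (suc L) ≈ ΦInner N (suc L) 1 0
  H₁₀-inner N L = trans (scaled-P _ L (suc L) (suc L) _ N) (inner N (suc L) 1 0 (λ m → (1# + a) * E L (Q * a) m)
    (≡.sym (ℕₚ.+-identityʳ L)) (≡.sym (ℕₚ.+-identityʳ L)) (linearFactor₁ L))

  H₁₁-inner : ∀ N L → H₁₁ N a b c L ≈ ΦInner N L 1 1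
  H₁₁-inner N L = trans (scaled-P _ L (suc L) L _ N) (inner N L 1 1 (λ m → (1# + a) * E L (Q * a) m)
    (≡.sym (ℕₚ.m+n∸n≡m L 1)) (≡.sym (ℕₚ.m+n∸n≡m L 1)) (linearFactor₁ L))

  H-zero : ∀ N → I 1 1# N ≈ 1#
  H-zero N = trans (*-cong (qbin-diagonal N) (1^n≈1 N)) (*-identityˡ 1#)
    where
    qbin-diagonal : ∀ m → qbin R Q m m ≈ 1#
    qbin-diagonal zero    = refl
    qbin-diagonal (suc m) = trans (+-cong (qbin-diagonal m) (trans (*-congˡ (qbin-diagonal-0 m)) (zeroʳ _))) (+-identityʳ 1#)

  I-coeff : ∀ N ν k → I (N ℕ.+ ν) e k ≈ e ^ k * qbin R Q ((N ℕ.+ k ℕ.+ ν) ∸ 1) k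
  I-coeff N ν k = trans (*-comm _ _) (*-congˡ (reflexive (≡.cong (λ j → qbin R Q (j ∸ 1) k) eq)))
    where
    eq : N ℕ.+ ν ℕ.+ k ≡ N ℕ.+ k ℕ.+ ν
    eq = ≡.trans (ℕₚ.+-assoc N ν k) (≡.trans (≡.cong (N ℕ.+_) (ℕₚ.+-comm ν k)) (≡.sym (ℕₚ.+-assoc N k ν)))

  -- The formula's sum stops at k = M - 1. The remaining term k = M of the convolution, where no
  -- rows are left for `h` and its value is 1, is the δ term.
  outer₀ : ∀ N M ν (h : Series) → h 0 ≈ 1# → (∀ L → h (suc L) ≈ ΦInner N (suc L) ν 0) →
    (I (N ℕ.+ ν) e ⊛ h) M ≈ ΦRHS R N M ν 0 a b c d
  outer₀ N M ν h h-zero h-suc rewrite ℕₚ.+-identityʳ M = begin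
    (I (N ℕ.+ ν) e ⊛ h) M
      ≈⟨ ⊛-as-sum (I (N ℕ.+ ν) e) h M ⟩
    sumBelow R M (λ k → I (N ℕ.+ ν) e k * h (M ∸ k)) + I (N ℕ.+ ν) e M * h (M ∸ M)
      ≈⟨ +-cong (sumBelow-cong-< M λ k k<M → *-cong (I-coeff N ν k) (h-pos (ℕₚ.m<n⇒0<n∸m k<M)))
           (trans (*-congˡ (trans (reflexive (≡.cong h (ℕₚ.n∸n≡0 M))) h-zero))
             (trans (*-identityʳ _) (trans (I-coeff N ν M) (*-congʳ (sym (*-identityˡ _)))))) ⟩
    sumBelow R M (λ k → e ^ k * qbin R Q ((N ℕ.+ k ℕ.+ ν) ∸ 1) k * ΦInner N (M ∸ k) ν 0)
      + 1# * e ^ M * qbin R Q ((N ℕ.+ M ℕ.+ ν) ∸ 1) M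
      ≈⟨ +-comm _ _ ⟩
    _ ∎
    where
    h-pos : ∀ {L} → 0 < L → h L ≈ ΦInner N L ν 0
    h-pos {suc L} _ = h-suc L

  -- For an odd number of rows the convolution is the whole sum up to k = M, and the δ term is zero.
  outer₁ : ∀ N M ν (h : Series) → (∀ L → h L ≈ ΦInner N L ν 1) →
    (I (N ℕ.+ ν) e ⊛ h) M ≈ ΦRHS R N M ν 1 a b c d
  outer₁ N M ν h h-eq rewrite ℕₚ.+-comm M 1 = begin
    (I (N ℕ.+ ν) e ⊛ h) M
      ≈⟨ ⊛-as-sum (I (N ℕ.+ ν) e) h M ⟩
    sumBelow R (suc M) (λ k → I (N ℕ.+ ν) e k * h (M ∸ k))
      ≈⟨ sumBelow-cong (suc M) (λ k → *-cong (I-coeff N ν k) (h-eq (M ∸ k))) ⟩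
    sumBelow R (suc M) (λ k → e ^ k * qbin R Q ((N ℕ.+ k ℕ.+ ν) ∸ 1) k * ΦInner N (M ∸ k) ν 1)
      ≈⟨ +-identityˡ _ ⟨
    0# + sumBelow R (suc M) (λ k → e ^ k * qbin R Q ((N ℕ.+ k ℕ.+ ν) ∸ 1) k * ΦInner N (M ∸ k) ν 1)
      ≈⟨ +-congʳ (trans (*-congʳ (zeroˡ _)) (zeroˡ _)) ⟨
    _ ∎

  2*n+0 : ∀ n → 2 ℕ.* n ℕ.+ 0 ≡ double n
  2*n+0 n = ≡.trans (ℕₚ.+-identityʳ _) (2*n≡double n)

  2*n+1 : ∀ n → 2 ℕ.* n ℕ.+ 1 ≡ suc (double n)
  2*n+1 n = ≡.trans (ℕₚ.+-comm _ 1) (≡.cong suc (2*n≡double n))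

  Φ-formula : ∀ N M ν μ → ν ≤ 1 → μ ≤ 1 →
    Φ R (2 ℕ.* N ℕ.+ ν) (2 ℕ.* M ℕ.+ μ) a b c d ≈ ΦRHS R N M ν μ a b c d
  Φ-formula N M zero zero _ _ rewrite 2*n+0 N | 2*n+0 M =
    trans (Φ≈chainSum (double N) (double M) a b c d)
      (trans (evens-double e N refl refl M)
        (trans (reflexive (≡.cong (λ n → (I n e ⊛ H₀₀ N a b c) M) (≡.sym (ℕₚ.+-identityʳ N))))
          (outer₀ N M 0 (H₀₀ N a b c) (trans (T₀₀-zero a b c N) (H-zero N)) (H₀₀-inner N))))
  Φ-formula N M zero (suc zero) _ _ rewrite 2*n+0 N | 2*n+1 M =
    trans (Φ≈chainSum (double N) (suc (double M)) a b c d)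
      (trans (odds-double e N refl refl M)
        (trans (reflexive (≡.cong (λ n → (I n e ⊛ H₀₁ N a b c) M) (≡.sym (ℕₚ.+-identityʳ N))))
          (outer₁ N M 0 (H₀₁ N a b c) (H₀₁-inner N))))
  Φ-formula N M (suc zero) zero _ _ rewrite 2*n+1 N | 2*n+0 M =
    trans (Φ≈chainSum (suc (double N)) (double M) a b c d)
      (trans (evens-suc-double e N refl refl M)
        (trans (reflexive (≡.cong (λ n → (I n e ⊛ H₁₀ N a b c) M) (ℕₚ.+-comm 1 N)))
          (outer₀ N M 1 (H₁₀ N a b c) (H-zero N) (H₁₀-inner N))))
  Φ-formula N M (suc zero) (suc zero) _ _ rewrite 2*n+1 N | 2*n+1 M =
    trans (Φ≈chainSum (suc (double N)) (suc (double M)) a b c d)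
      (trans (odds-suc-double e N refl refl M)
        (trans (reflexive (≡.cong (λ n → (I n e ⊛ H₁₁ N a b c) M) (ℕₚ.+-comm 1 N)))
          (outer₁ N M 1 (H₁₁ N a b c) (H₁₁-inner N))))
  Φ-formula N M (suc (suc _)) _ (s≤s ()) _
  Φ-formula N M zero (suc (suc _)) _ (s≤s ())
  Φ-formula N M (suc zero) (suc (suc _)) _ (s≤s ())

  -- The signs of the two factors combine to (-1)ᵐ independently of `k` and leave the sum.
  D-coeff : ∀ i j m → D e i j m ≈ pow R (- 1#) m * sumBelow R (suc m) (λ k →
    qbin R Q i k * qbin R Q j (m ∸ k) * pow R e (m ∸ k) * pow R Q ((k ℕ.* (k ℕ.+ 1) ℕ.+ m C 2) ∸ (k ℕ.* m)))
  D-coeff i j m = begin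
    D e i j m
      ≈⟨ ⊛-as-sum (E i (- 1# * Q)) (E j (- 1# * e)) m ⟩
    sumBelow R (suc m) (λ k → E i (- 1# * Q) k * E j (- 1# * e) (m ∸ k))
      ≈⟨ sumBelow-cong-< (suc m) (λ { k (s≤s k≤m) → split k k≤m }) ⟩
    sumBelow R (suc m) (λ k → s ^ m * term m k)
      ≈⟨ *-distribˡ-sumBelow (s ^ m) (suc m) (term m) ⟨
    s ^ m * sumBelow R (suc m) (term m) ∎
    where
    s = - 1#
    term : ℕ → ℕ → Carrier
    term m k = qbin R Q i k * qbin R Q j (m ∸ k) * e ^ (m ∸ k) * Q ^ ((k ℕ.* (k ℕ.+ 1) ℕ.+ m C 2) ∸ (k ℕ.* m))
    -- Writing `m` as `k + l` makes the truncated exponent exact, so that `Ψ-exponent` applies.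
    split′ : ∀ k l → E i (s * Q) k * E j (s * e) l ≈
      s ^ (k ℕ.+ l) * (qbin R Q i k * qbin R Q j l * e ^ l * Q ^ ((k ℕ.* (k ℕ.+ 1) ℕ.+ (k ℕ.+ l) C 2) ∸ (k ℕ.* (k ℕ.+ l))))
    split′ k l = begin
      u * (p * (s * Q) ^ k) * (v * (r * (s * e) ^ l))
        ≈⟨ *-cong (*-congˡ (*-congˡ (*-^ s Q k))) (*-congˡ (*-congˡ (*-^ s e l))) ⟩
      u * (p * (s ^ k * Q ^ k)) * (v * (r * (s ^ l * e ^ l)))
        ≈⟨ solve 8 (λ u p x y v r z w → u :* (p :* (x :* y)) :* (v :* (r :* (z :* w))) :=
                                        x :* z :* (u :* v :* w :* (y :* p :* r))) refl
             u p (s ^ k) (Q ^ k) v r (s ^ l) (e ^ l) ⟩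
      s ^ k * s ^ l * (u * v * e ^ l * (Q ^ k * p * r))
        ≈⟨ *-cong (^-+ s k l) (*-congˡ (trans (^-+ Q (k ℕ.+ k C 2) (l C 2)) (*-congʳ (^-+ Q k (k C 2))))) ⟨
      s ^ (k ℕ.+ l) * (u * v * e ^ l * Q ^ (k ℕ.+ k C 2 ℕ.+ l C 2))
        ≈⟨ *-congˡ (*-congˡ (reflexive (≡.cong (Q ^_) (Ψ-exponent k l)))) ⟨
      _ ∎
      where
      u = qbin R Q i k
      v = qbin R Q j l
      p = Q ^ (k C 2)
      r = Q ^ (l C 2)
    split : ∀ k → k ≤ m → E i (s * Q) k * E j (s * e) (m ∸ k) ≈ s ^ m * term m k
    split k k≤m = trans (split′ k (m ∸ k)) (reflexive
      (≡.cong (λ n → s ^ n * (qbin R Q i k * qbin R Q j (m ∸ k) * e ^ (m ∸ k) * Q ^ ((k ℕ.* (k ℕ.+ 1) ℕ.+ n C 2) ∸ (k ℕ.* n))))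
        (ℕₚ.m+[n∸m]≡n k≤m)))

  D-evens-coeff : ∀ N M → (D e (N / 2) ((N ℕ.+ 1) / 2) ⊛ evens id N a b c d) M ≈ ΨRHS R N (double M) a b c d
  D-evens-coeff N M rewrite double/2 M = trans (⊛-as-sum (D e (N / 2) ((N ℕ.+ 1) / 2)) (evens id N a b c d) M)
    (sumBelow-cong (suc M) λ m → *-cong (D-coeff (N / 2) ((N ℕ.+ 1) / 2) m)
      (trans (sym (Φ≈chainSum N (double (M ∸ m)) a b c d))
        (reflexive (≡.cong (λ j → Φ R N j a b c d) (≡.sym (double-∸ M m))))))

  D-odds-coeff : ∀ N M → (D e (N / 2) ((N ℕ.+ 1) / 2) ⊛ odds id N a b c d) M ≈ ΨRHS R N (suc (double M)) a b c d
  D-odds-coeff N M rewrite suc-double/2 M = trans (⊛-as-sum (D e (N / 2) ((N ℕ.+ 1) / 2)) (odds id N a b c d) M)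
    (sumBelow-cong-< (suc M) λ { m (s≤s m≤M) → *-cong (D-coeff (N / 2) ((N ℕ.+ 1) / 2) m)
      (trans (sym (Φ≈chainSum N (suc (double (M ∸ m))) a b c d))
        (reflexive (≡.cong (λ j → Φ R N j a b c d) (≡.sym (suc-double-∸ m≤M))))) })

  D-double : ∀ n → D e n n ≡ D e (double n / 2) ((double n ℕ.+ 1) / 2)
  D-double n = ≡.cong₂ (D e) (≡.sym (double/2 n))
    (≡.sym (≡.trans (≡.cong (_/ 2) (ℕₚ.+-comm (double n) 1)) (suc-double/2 n)))

  D-suc-double : ∀ n → D e n (suc n) ≡ D e (suc (double n) / 2) ((suc (double n) ℕ.+ 1) / 2)
  D-suc-double n = ≡.cong₂ (D e) (≡.sym (suc-double/2 n))
    (≡.sym (≡.trans (≡.cong (λ k → suc k / 2) (ℕₚ.+-comm (double n) 1)) (double/2 (suc n))))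

  -- The parity of `N` fixes the numbers ⌊N/2⌋ and ⌈N/2⌉ of factors in `D`; the parity of `M`
  -- selects the row series whose coefficient is taken.
  Ψ-formula : ∀ N M → Ψ R N M a b c d ≈ ΨRHS R N M a b c d
  Ψ-formula N M = trans (Ψ≈chainSum N M a b c d) (go (halfView N) (halfView M))
    where
    via : ∀ {f g : Series} (F : Series) M → f ≡ g → (f ⊛ F) M ≈ (g ⊛ F) M
    via F M eq = reflexive (≡.cong (λ f → (f ⊛ F) M) eq)
    go : ∀ {N M} → HalfView N → HalfView M → chainSum pred N M a b c d ≈ ΨRHS R N M a b c d
    go (even n) (even M) = trans (evens-pred-double e n refl refl M)
      (trans (via (evens id (double n) a b c d) M (D-double n)) (D-evens-coeff (double n) M))
    go (even n) (odd M)  = trans (odds-pred-double e n refl refl M)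
      (trans (via (odds id (double n) a b c d) M (D-double n)) (D-odds-coeff (double n) M))
    go (odd n)  (even M) = trans (evens-pred-suc-double e n refl refl M)
      (trans (via (evens id (suc (double n)) a b c d) M (D-suc-double n)) (D-evens-coeff (suc (double n)) M))
    go (odd n)  (odd M)  = trans (odds-pred-suc-double e n refl refl M)
      (trans (via (odds id (suc (double n)) a b c d) M (D-suc-double n)) (D-odds-coeff (suc (double n)) M))

open import Data.Nat using (_+_; _*_)

theorem4p7 : {ℓ₁ ℓ₂ : Level} (R : CommutativeRing ℓ₁ ℓ₂)
    → (a b c d : CommutativeRing.Carrier R)
    → ((N M ν μ : ℕ) → ν ≤ 1 → μ ≤ 1 → 1 ≤ N + ν
    → CommutativeRing._≈_ R (Φ R (2 * N + ν) (2 * M + μ) a b c d) (ΦRHS R N M ν μ a b c d))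
    × ((N M : ℕ)
    → CommutativeRing._≈_ R (Ψ R N M a b c d) (ΨRHS R N M a b c d))
theorem4p7 R a b c d = (λ N M ν μ ν≤1 μ≤1 _ → Φ-formula N M ν μ ν≤1 μ≤1) , Ψ-formula
  where open Conversion R a b c d
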